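{- Let $k\ge3$ and $2\le i\le k-1$. For every $n\ge0$, the number of superpartitions $(\lambda_1,\dots,\lambda_s)$ of $n$ such that, for all $\ell$ with $\ell+k-1\le s$, $\lambda_\ell-\lambda_{\ell+k-1}\ge1$ if $\lambda_\ell$ is overlined and $\lambda_\ell-\lambda_{\ell+k-1}\ge2$ otherwise, and such that the number of non-overlined parts equal to $1$ plus the number of parts $\overline{0}$ is at most $i-1$, equals the number of overpartitions of $n$ whose non-overlined parts are not congruent to $0,\pm i$ modulo $2k$ plus the number of overpartitions of $n$ whose non-overlined parts are not congruent to $0,\pm(i-1)$ modulo $2k$.
   Context: An overpartition of $n$ is a non-increasing sequence of positive integers summing to $n$ in which the final occurrence of each value may be overlined. A superpartition of $n$ is a non-increasing sequence of parts summing to $n$ in which the first occurrence of each value may be overlined and the part $\overline{0}$ may appear (at most once); non-overlined parts are positive integers and overlined parts are distinct nonnegative integers. -}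

module Defs where

open import Data.Nat using (ℕ; zero; suc; _+_; _*_; _∸_; _≤_; _<_)
open import Data.Bool using (Bool; true; false; if_then_else_; _∧_; not)
open import Data.Product using (_×_; _,_; proj₁; proj₂; ∃-syntax)
open import Data.List using (List; []; _∷_; length; drop; head; map)
open import Data.Nat.ListAction using (sum)
open import Data.List.Relation.Unary.Unique.Propositional using (Unique)
open import Data.List.Membership.Propositional using (_∈_)
open import Data.Maybe using (Maybe; just; nothing)
open import Data.Unit using (⊤)
open import Data.Empty using (⊥)
open import Relation.Nullary using (¬_)
open import Relation.Binary.PropositionalEquality using (_≡_)
open import Function.Bundles using (_⇔_)

Part : Set
Part = ℕ × Bool

val : Part → ℕ
val = proj₁

ovl : Part → Bool
ovl = proj₂

total : List Part → ℕ
total ps = sum (map val ps)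

NonIncr : List Part → Set
NonIncr [] = ⊤
NonIncr (p ∷ []) = ⊤
NonIncr (p ∷ q ∷ ps) = (val q ≤ val p) × NonIncr (q ∷ ps)

LastOcc : List Part → Set
LastOcc [] = ⊤
LastOcc (p ∷ []) = ⊤
LastOcc (p ∷ q ∷ ps) = (ovl p ≡ true → val q < val p) × LastOcc (q ∷ ps)

AllPos : List Part → Set
AllPos [] = ⊤
AllPos (p ∷ ps) = (0 < val p) × AllPos ps

IsOverpartition : ℕ → List Part → Set
IsOverpartition n ps = NonIncr ps × LastOcc ps × AllPos ps × total ps ≡ n

-- Superpartition: non-increasing; only the first occurrence of a value may be
-- overlined (an overlined part is preceded by a strictly larger value, or by
-- nothing); non-overlined parts are positive; overlined parts are nonnegative
-- (distinctness of overlined parts, and at most one 0̄, follow from the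
-- first-occurrence condition).
FirstOcc : List Part → Set
FirstOcc [] = ⊤
FirstOcc (p ∷ []) = ⊤
FirstOcc (p ∷ q ∷ ps) = (ovl q ≡ true → val q < val p) × FirstOcc (q ∷ ps)

NonOvlPos : List Part → Set
NonOvlPos [] = ⊤
NonOvlPos (p ∷ ps) = (ovl p ≡ false → 0 < val p) × NonOvlPos ps

IsSuperpartition : ℕ → List Part → Set
IsSuperpartition n ps = NonIncr ps × FirstOcc ps × NonOvlPos ps × total ps ≡ n

-- Difference condition: for every ℓ with ℓ + k - 1 ≤ s,
-- λ_ℓ - λ_{ℓ+k-1} ≥ 1 if λ_ℓ is overlined, ≥ 2 otherwise.
-- For λ_ℓ = p with tail rest, λ_{ℓ+k-1} is the element of rest at index k-2.
gap : Part → ℕ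
gap p = if ovl p then 1 else 2

DiffCond : ℕ → List Part → Set
DiffCond k [] = ⊤
DiffCond k (p ∷ rest) =
  (∀ q → head (drop (k ∸ 2) rest) ≡ just q → val q + gap p ≤ val p)
  × DiffCond k rest

countP : (Part → Bool) → List Part → ℕ
countP f [] = 0
countP f (p ∷ ps) = (if f p then 1 else 0) + countP f ps

isNonOvlOne : Part → Bool
isNonOvlOne (1 , false) = true
isNonOvlOne _ = false

isOvlZero : Part → Bool
isOvlZero (0 , true) = true
isOvlZero _ = false

GoodSuper : ℕ → ℕ → ℕ → List Part → Set
GoodSuper k i n ps =
  IsSuperpartition n ps × DiffCond k ps
  × countP isNonOvlOne ps + countP isOvlZero ps ≤ i ∸ 1

CongMod : ℕ → ℕ → ℕ → Set
CongMod m a b = ∃[ x ] ∃[ y ] a + x * m ≡ b + y * m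

AvoidRes : ℕ → ℕ → List Part → Set
AvoidRes m r [] = ⊤
AvoidRes m r (p ∷ ps) =
  (ovl p ≡ false →
     ¬ CongMod m (val p) 0 × ¬ CongMod m (val p) r × ¬ CongMod m (val p + r) 0)
  × AvoidRes m r ps

GoodOver : ℕ → ℕ → ℕ → List Part → Set
GoodOver k r n ps = IsOverpartition n ps × AvoidRes (2 * k) r ps

HasCount : {A : Set} → (A → Set) → ℕ → Set
HasCount {A} P c = ∃[ L ] Unique L × (∀ x → (x ∈ L) ⇔ P x) × length L ≡ c

{-# OPTIONS --safe #-}
-- Let T m i = Σ_{n∈ℤ} (-1)ⁿ q^(n(kn+k-i+km)) Π_{j=1}^{m} (1-q^(n+j))/(1+q^(n+j)); the terms with
-- -m ≤ n ≤ -1 vanish, and n ↦ -n-m-1 pairs the negative indices with the nonnegative ones.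
-- That reflection gives
--   T m (i+1) - T m i = q^((m+1)i) (T (m+1) (k-i) + q^(m+1) T (m+1) (k-i-1)),
-- which is the rule for adding the parts m+1 to a superpartition with parts at most m. Hence the sum of
-- q^|λ| T m (k-c(λ)) over the superpartitions λ with parts at most m, where c(λ) is the number of parts
-- equal to m (plus k-i when m = 0), does not depend on m. At m = 0 it is T 0 i + T 0 (i-1), which by the
-- Jacobi triple product is a sum of two products; as m → ∞ it tends to (q)_∞/(-q)_∞ times the generating
-- function of the superpartitions.
-- All series are taken modulo q^D, which makes every sum and product finite.
module Submission where

open import Algebra.Bundles using (CommutativeRing)
import Algebra.Solver.Ring.AlmostCommutativeRing as ACR
import Data.Integer as ℤ
import Data.Integer.Properties as ℤ
open import Data.Nat as ℕ using (ℕ; zero; suc; _≤_; _<_; s≤s; z≤n)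
import Data.Nat.Properties as ℕ
open import Data.Nat.Tactic.RingSolver using (solve-∀)
open import Data.Product using (_×_; _,_; proj₁; proj₂; ∃-syntax)
open import Function using (_∘_)
open import Level using (0ℓ)
open import Relation.Nullary using (¬_; Dec; yes; no; contradiction)

open import Defs

-- A superpartition with parts at most m needs to remember only c(λ). A plain m+1 tolerates at most
-- k-2 later parts of value at least m, an overlined m+1 at most k-2 later parts equal to m+1. So f
-- plain copies can be added when f + c(λ) < k, and an overlined copy with them when moreover f + 1
-- < k. Iterating the recurrence down to T m 0 = 0 writes T m (k-c) as a sum over f < k-c with one
-- summand for each such choice. Hence T m (k-c(λ)) is, up to the common factor (q)_∞/(-q)_∞, the
-- generating function of the ways to add parts larger than m to λ, and this is why the weighted sum
-- is constant. The choice f = k-1 with an overlined copy is forbidden but needs no exception, since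
-- its summand is a multiple of T (m+1) 0. No negative exponent or true division occurs: negative
-- indices are folded onto nonnegative ones, and reciprocals are truncated geometric series. The
-- excluded residues 0, ±i modulo 2k are the exponents of the triple product with base q^(2k), whose
-- two parameters are q^i and q^(2k-i).

module PowerSeries where

  open import Data.Integer using (ℤ; 0ℤ; 1ℤ)
  open import Data.Integer.Solver using (module +-*-Solver)
  open import Relation.Binary.PropositionalEquality

  -- Integer power series modulo q^D

  Series : Set
  Series = ℕ → ℤ

  infixl 6 _⊕_
  infixl 7 _⊛_

  _⊕_ : Series → Series → Series
  (f ⊕ g) d = f d ℤ.+ g d

  const : ℤ → Series
  const z zero    = z
  const z (suc _) = 0ℤ

  X : ℕ → Series
  X zero            = const 1ℤ
  X (suc e) zero    = 0ℤ
  X (suc e) (suc d) = X e d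

  tail : Series → Series
  tail f d = f (suc d)

  _⊛_ : Series → Series → Series
  (f ⊛ g) zero    = f 0 ℤ.* g 0
  (f ⊛ g) (suc d) = f 0 ℤ.* g (suc d) ℤ.+ (tail f ⊛ g) d

  -- A coefficient of a Cauchy product uses only coefficients of no larger degree. This makes
  -- agreement below degree `D` a congruence for the product.
  ⊛-cong-≤ : ∀ {f f′ g g′} d → (∀ e → e ℕ.≤ d → f e ≡ f′ e) →
             (∀ e → e ℕ.≤ d → g e ≡ g′ e) → (f ⊛ g) d ≡ (f′ ⊛ g′) d
  ⊛-cong-≤ zero    p q = cong₂ ℤ._*_ (p 0 z≤n) (q 0 z≤n)
  ⊛-cong-≤ (suc d) p q = cong₂ ℤ._+_
    (cong₂ ℤ._*_ (p 0 z≤n) (q (suc d) ℕ.≤-refl))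
    (⊛-cong-≤ d (λ e e≤d → p (suc e) (s≤s e≤d)) (λ e e≤d → q e (ℕ.m≤n⇒m≤1+n e≤d)))

  ⊛-distribʳ : ∀ h f g → (f ⊕ g) ⊛ h ≗ (f ⊛ h) ⊕ (g ⊛ h)
  ⊛-distribʳ h f g zero    = ℤ.*-distribʳ-+ (h 0) (f 0) (g 0)
  ⊛-distribʳ h f g (suc d) rewrite ⊛-distribʳ h (tail f) (tail g) d =
    solve 5 (λ a b x s t → (a :+ b) :* x :+ (s :+ t) := (a :* x :+ s) :+ (b :* x :+ t)) refl
      (f 0) (g 0) (h (suc d)) ((tail f ⊛ h) d) ((tail g ⊛ h) d)
    where open +-*-Solver

  ⊛-scaleˡ : ∀ z f g → (λ d → z ℤ.* f d) ⊛ g ≗ (λ d → z ℤ.* (f ⊛ g) d)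
  ⊛-scaleˡ z f g zero    = ℤ.*-assoc z (f 0) (g 0)
  ⊛-scaleˡ z f g (suc d) rewrite ⊛-scaleˡ z (tail f) g d =
    solve 4 (λ z a x s → z :* a :* x :+ z :* s := z :* (a :* x :+ s)) refl
      z (f 0) (g (suc d)) ((tail f ⊛ g) d)
    where open +-*-Solver

  ⊛-assoc : ∀ f g h → (f ⊛ g) ⊛ h ≗ f ⊛ (g ⊛ h)
  ⊛-assoc f g h zero    = ℤ.*-assoc (f 0) (g 0) (h 0)
  ⊛-assoc f g h (suc d)
    rewrite ⊛-distribʳ h (λ e → f 0 ℤ.* g (suc e)) (tail f ⊛ g) d
          | ⊛-scaleˡ (f 0) (tail g) h d
          | ⊛-assoc (tail f) g h d =
    solve 5 (λ a b x s t → a :* b :* x :+ (a :* s :+ t) := a :* (b :* x :+ s) :+ t) refl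
      (f 0) (g 0) (h (suc d)) ((tail g ⊛ h) d) ((tail f ⊛ (g ⊛ h)) d)
    where open +-*-Solver

  -- The definition of `_⊛_` peels the left factor; peeling the right one instead is what lets
  -- `⊛-comm` go by induction on the degree.
  ⊛-suc : ∀ f g d → (f ⊛ g) (suc d) ≡ g 0 ℤ.* f (suc d) ℤ.+ (f ⊛ tail g) d
  ⊛-suc f g zero = solve 4 (λ a b c d → a :* b :+ c :* d := d :* c :+ a :* b) refl
    (f 0) (g 1) (f 1) (g 0)
    where open +-*-Solver
  ⊛-suc f g (suc d) rewrite ⊛-suc (tail f) g d =
    solve 3 (λ a b c → a :+ (b :+ c) := b :+ (a :+ c)) refl
      (f 0 ℤ.* g (suc (suc d))) (g 0 ℤ.* f (suc (suc d))) ((tail f ⊛ tail g) d)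
    where open +-*-Solver

  ⊛-comm : ∀ f g → f ⊛ g ≗ g ⊛ f
  ⊛-comm f g zero    = ℤ.*-comm (f 0) (g 0)
  ⊛-comm f g (suc d) = trans (⊛-suc f g d)
    (cong (λ s → g 0 ℤ.* f (suc d) ℤ.+ s) (⊛-comm f (tail g) d))

  const-⊛ : ∀ z g → const z ⊛ g ≗ (λ d → z ℤ.* g d)
  const-⊛ z g zero    = refl
  const-⊛ z g (suc d) = trans (cong (λ s → z ℤ.* g (suc d) ℤ.+ s) (zero-⊛ d))
    (ℤ.+-identityʳ _)
    where
    zero-⊛ : ∀ d → ((λ _ → 0ℤ) ⊛ g) d ≡ 0ℤ
    zero-⊛ zero    = refl
    zero-⊛ (suc d) = trans (ℤ.+-identityˡ _) (zero-⊛ d)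

  X-+ : ∀ a b → X (a ℕ.+ b) ≗ X a ⊛ X b
  X-+ zero    b d       = sym (trans (const-⊛ 1ℤ (X b) d) (ℤ.*-identityˡ _))
  X-+ (suc a) b zero    = refl
  X-+ (suc a) b (suc d) = trans (X-+ a b d) (sym (ℤ.+-identityˡ _))

  X-below : ∀ {e} d → d < e → X e d ≡ 0ℤ
  X-below {suc e} zero    _         = refl
  X-below {suc e} (suc d) (s≤s d<e) = X-below d d<e

  X-diag : ∀ e → X e e ≡ 1ℤ
  X-diag zero    = refl
  X-diag (suc e) = X-diag e

  X-off : ∀ e d → e ≢ d → X e d ≡ 0ℤ
  X-off zero    zero    e≢d with () ← e≢d refl
  X-off zero    (suc d) e≢d = refl
  X-off (suc e) zero    e≢d = refl
  X-off (suc e) (suc d) e≢d = X-off e d (λ eq → e≢d (cong suc eq))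

  -- ℤ[[q]]/(q^D), with the quotient expressed by the setoid equality.
  seriesRing : ℕ → CommutativeRing 0ℓ 0ℓ
  seriesRing D = record
    { Carrier = Series
    ; _≈_ = λ f g → ∀ d → d < D → f d ≡ g d
    ; _+_ = _⊕_
    ; _*_ = _⊛_
    ; -_ = λ f d → ℤ.- f d
    ; 0# = const 0ℤ
    ; 1# = const 1ℤ
    ; isCommutativeRing = record
      { isRing = record
        { +-isAbelianGroup = record
          { isGroup = record
            { isMonoid = record
              { isSemigroup = record
                { isMagma = record
                  { isEquivalence = record
                    { refl = λ _ _ → refl
                    ; sym = λ p d d<D → sym (p d d<D)
                    ; trans = λ p q d d<D → trans (p d d<D) (q d d<D)
                    }
                  ; ∙-cong = λ p q d d<D → cong₂ ℤ._+_ (p d d<D) (q d d<D)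
                  }
                ; assoc = λ f g h d _ → ℤ.+-assoc (f d) (g d) (h d)
                }
              ; identity =
                  (λ { f zero _ → ℤ.+-identityˡ _ ; f (suc d) _ → ℤ.+-identityˡ _ })
                , (λ { f zero _ → ℤ.+-identityʳ _ ; f (suc d) _ → ℤ.+-identityʳ _ })
              }
            ; inverse =
                (λ { f zero _ → ℤ.+-inverseˡ (f 0) ; f (suc d) _ → ℤ.+-inverseˡ (f (suc d)) })
              , (λ { f zero _ → ℤ.+-inverseʳ (f 0) ; f (suc d) _ → ℤ.+-inverseʳ (f (suc d)) })
            ; ⁻¹-cong = λ p d d<D → cong ℤ.-_ (p d d<D)
            }
          ; comm = λ f g d _ → ℤ.+-comm (f d) (g d)
          }
        ; *-cong = λ p q d d<D → ⊛-cong-≤ d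
            (λ e e≤d → p e (ℕ.≤-<-trans e≤d d<D)) (λ e e≤d → q e (ℕ.≤-<-trans e≤d d<D))
        ; *-assoc = λ f g h d _ → ⊛-assoc f g h d
        ; *-identity = (λ f d _ → 1⊛ f d) , (λ f d _ → trans (⊛-comm f _ d) (1⊛ f d))
        ; distrib =
            (λ f g h d _ → trans (⊛-comm f (g ⊕ h) d)
               (trans (⊛-distribʳ f g h d) (cong₂ ℤ._+_ (⊛-comm g f d) (⊛-comm h f d))))
          , (λ f g h d _ → ⊛-distribʳ f g h d)
        }
      ; *-comm = λ f g d _ → ⊛-comm f g d
      }
    }
    where
    1⊛ : ∀ f → const 1ℤ ⊛ f ≗ f
    1⊛ f d = trans (const-⊛ 1ℤ f d) (ℤ.*-identityˡ _)

  -- Gives the ring solver integer coefficients, on which cancellation can be decided.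
  const-morphism : ∀ D → ℤ.+-*-rawRing ACR.-Raw-AlmostCommutative⟶ ACR.fromCommutativeRing (seriesRing D)
  const-morphism D = record
    { ⟦_⟧ = const
    ; +-homo = λ { x y zero _ → refl ; x y (suc d) _ → refl }
    ; *-homo = λ x y d _ → sym (trans (const-⊛ x (const y) d) (scale x y d))
    ; -‿homo = λ { x zero _ → refl ; x (suc d) _ → refl }
    ; 0-homo = λ _ _ → refl
    ; 1-homo = λ _ _ → refl
    }
    where
    scale : ∀ x y d → x ℤ.* const y d ≡ const (x ℤ.* y) d
    scale x y zero    = refl
    scale x y (suc d) = ℤ.*-zeroʳ x

-- Finite sums, products and reciprocals in a truncated ring

module Truncated where

  import Algebra.Solver.Ring as RingSolver
  open import Data.Maybe using (Maybe; just; nothing)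
  open import Data.Sum using (inj₁; inj₂)
  open import Relation.Binary.PropositionalEquality as ≡ using (_≡_)

  -- The q-identities use only a multiplicative family of powers that vanishes from exponent `D` on.
  -- Stated over this interface, they never mention coefficients.
  record Truncation : Set₁ where
    field
      R        : CommutativeRing 0ℓ 0ℓ
      morphism : ℤ.+-*-rawRing ACR.-Raw-AlmostCommutative⟶ ACR.fromCommutativeRing R
    open CommutativeRing R
    field
      X      : ℕ → Carrier
      X-0    : X 0 ≈ 1#
      X-+    : ∀ a b → X (a ℕ.+ b) ≈ X a * X b
      D      : ℕ
      0<D    : 0 < D
      X-high : ∀ {e} → D ≤ e → X e ≈ 0#

  module Identities (trunc : Truncation) where

    open Truncation trunc
    open CommutativeRing R
    open import Algebra.Properties.Ring ring using (-0#≈0#)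
    open import Relation.Binary.Reasoning.Setoid setoid

    private
      ≟-coeff : ∀ x y → Maybe (ACR.Induced-equivalence morphism x y)
      ≟-coeff x y with x ℤ.≟ y
      ... | yes ≡.refl = just refl
      ... | no _       = nothing

    open RingSolver ℤ.+-*-rawRing (ACR.fromCommutativeRing R) morphism ≟-coeff
      using (solve; _:=_; _:+_; _:*_; _:-_; :-_; _:^_) public

    X-≡ : ∀ {a b} → a ≡ b → X a ≈ X b
    X-≡ ≡.refl = refl

    X-split : ∀ {a b c} → c ≡ a ℕ.+ b → X c ≈ X a * X b
    X-split {a} {b} eq = trans (X-≡ eq) (X-+ a b)

    Σ< : ℕ → (ℕ → Carrier) → Carrier
    Σ< zero    f = 0#
    Σ< (suc n) f = Σ< n f + f n

    Σ<-cong : ∀ n {f g} → (∀ i → i < n → f i ≈ g i) → Σ< n f ≈ Σ< n g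
    Σ<-cong zero    p = refl
    Σ<-cong (suc n) p = +-cong (Σ<-cong n (λ i i<n → p i (ℕ.m<n⇒m<1+n i<n))) (p n ℕ.≤-refl)

    Σ<-zero : ∀ n {f} → (∀ i → i < n → f i ≈ 0#) → Σ< n f ≈ 0#
    Σ<-zero zero    p = refl
    Σ<-zero (suc n) p = trans (+-cong (Σ<-zero n (λ i i<n → p i (ℕ.m<n⇒m<1+n i<n))) (p n ℕ.≤-refl))
      (+-identityʳ 0#)

    Σ<-+ : ∀ n f g → Σ< n (λ i → f i + g i) ≈ Σ< n f + Σ< n g
    Σ<-+ zero    f g = sym (+-identityʳ 0#)
    Σ<-+ (suc n) f g = trans (+-congʳ (Σ<-+ n f g))
      (solve 4 (λ a b c d → a :+ b :+ (c :+ d) := a :+ c :+ (b :+ d)) refl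
        (Σ< n f) (Σ< n g) (f n) (g n))

    Σ<-*ˡ : ∀ n c f → Σ< n (λ i → c * f i) ≈ c * Σ< n f
    Σ<-*ˡ zero    c f = sym (zeroʳ c)
    Σ<-*ˡ (suc n) c f = trans (+-congʳ (Σ<-*ˡ n c f)) (sym (distribˡ c _ _))

    Σ<-head : ∀ n f → Σ< (suc n) f ≈ f 0 + Σ< n (f ∘ suc)
    Σ<-head zero    f = +-comm 0# (f 0)
    Σ<-head (suc n) f = trans (+-congʳ (Σ<-head n f)) (+-assoc _ _ _)

    Σ<-trim : ∀ m n {f} → (∀ i → n ≤ i → f i ≈ 0#) → Σ< (m ℕ.+ n) f ≈ Σ< n f
    Σ<-trim zero    n p = refl
    Σ<-trim (suc m) n p = trans (+-cong (Σ<-trim m n p) (p (m ℕ.+ n) (ℕ.m≤n+m n m))) (+-identityʳ _)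

    Π< : ℕ → (ℕ → Carrier) → Carrier
    Π< zero    f = 1#
    Π< (suc n) f = Π< n f * f n

    Π<-cong : ∀ n {f g} → (∀ i → i < n → f i ≈ g i) → Π< n f ≈ Π< n g
    Π<-cong zero    p = refl
    Π<-cong (suc n) p = *-cong (Π<-cong n (λ i i<n → p i (ℕ.m<n⇒m<1+n i<n))) (p n ℕ.≤-refl)

    Π<-* : ∀ n f g → Π< n (λ i → f i * g i) ≈ Π< n f * Π< n g
    Π<-* zero    f g = sym (*-identityʳ 1#)
    Π<-* (suc n) f g = trans (*-congʳ (Π<-* n f g))
      (solve 4 (λ a b c d → a :* b :* (c :* d) := a :* c :* (b :* d)) refl
        (Π< n f) (Π< n g) (f n) (g n))

    Π<-trim : ∀ m n {f} → (∀ i → n ≤ i → f i ≈ 1#) → Π< (m ℕ.+ n) f ≈ Π< n f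
    Π<-trim zero    n p = refl
    Π<-trim (suc m) n p = trans (*-cong (Π<-trim m n p) (p (m ℕ.+ n) (ℕ.m≤n+m n m))) (*-identityʳ _)

    Π<-+ : ∀ m n f → Π< (m ℕ.+ n) f ≈ Π< n f * Π< m (λ i → f (n ℕ.+ i))
    Π<-+ zero    n f = sym (*-identityʳ _)
    Π<-+ (suc m) n f = trans (*-cong (Π<-+ m n f) (reflexive (≡.cong f (ℕ.+-comm m n))))
      (*-assoc _ _ _)

    Π<-block : ∀ L w f → Π< (L ℕ.* w) f ≈ Π< L (λ l → Π< w (λ s → f (l ℕ.* w ℕ.+ s)))
    Π<-block zero    w f = refl
    Π<-block (suc L) w f = trans (Π<-+ w (L ℕ.* w) f) (*-congʳ (Π<-block L w f))

    -- `pw` is an abstract sequence of powers of `y`, so that the same telescoping serves q^e and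
    -- -q^e.
    geometric : ∀ y pw → pw 0 ≈ 1# → (∀ f → pw (suc f) ≈ y * pw f) →
                ∀ n → (1# - y) * Σ< n pw ≈ 1# - pw n
    geometric y pw pw-0 pw-suc zero = trans (zeroʳ _)
      (sym (trans (+-congˡ (-‿cong pw-0)) (-‿inverseʳ 1#)))
    geometric y pw pw-0 pw-suc (suc n) = begin
      (1# - y) * (Σ< n pw + pw n)          ≈⟨ distribˡ _ _ _ ⟩
      (1# - y) * Σ< n pw + (1# - y) * pw n ≈⟨ +-congʳ (geometric y pw pw-0 pw-suc n) ⟩
      (1# - pw n) + (1# - y) * pw n
        -- A zeroth power is how `1#` is written for the solver here and below: it denotes `1#`
        -- itself, whereas a solver constant would denote an image under the abstract `morphism`.
        ≈⟨ solve 2 (λ y p → (y :^ 0 :- p) :+ (y :^ 0 :- y) :* p := y :^ 0 :- y :* p) refl y (pw n) ⟩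
      1# - y * pw n                        ≈⟨ +-congˡ (-‿cong (pw-suc n)) ⟨
      1# - pw (suc n)                      ∎

    sgn : ℕ → Carrier
    sgn zero    = 1#
    sgn (suc n) = - sgn n

    -- Reciprocals of 1 - q^e and 1 + q^e. For e > 0 the power q^(De) is already zero, so `D` terms
    -- of the geometric series suffice.
    inv⁻ inv⁺ : ℕ → Carrier
    inv⁻ e = Σ< D (λ f → X (f ℕ.* e))
    inv⁺ e = Σ< D (λ f → sgn f * X (f ℕ.* e))

    private
      X-top : ∀ {e} → 0 < e → X (D ℕ.* e) ≈ 0#
      X-top {suc e} _ = X-high (ℕ.m≤m*n D (suc e))

      1-0 : ∀ {x} → x ≈ 0# → 1# - x ≈ 1#
      1-0 eq = trans (+-congˡ (trans (-‿cong eq) -0#≈0#)) (+-identityʳ 1#)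

    inv⁻-inverse : ∀ {e} → 0 < e → (1# - X e) * inv⁻ e ≈ 1#
    inv⁻-inverse {e} 0<e = trans
      (geometric (X e) (λ f → X (f ℕ.* e)) X-0 (λ f → X-+ e (f ℕ.* e)) D)
      (1-0 (X-top 0<e))

    inv⁺-inverse : ∀ {e} → 0 < e → (1# + X e) * inv⁺ e ≈ 1#
    inv⁺-inverse {e} 0<e = begin
      (1# + X e) * inv⁺ e ≈⟨ *-congʳ (solve 1 (λ x → x :^ 0 :+ x := x :^ 0 :- (:- x)) refl (X e)) ⟩
      (1# - - X e) * inv⁺ e
        ≈⟨ geometric (- X e) _ (trans (*-identityˡ _) X-0) step D ⟩
      1# - sgn D * X (D ℕ.* e) ≈⟨ 1-0 (trans (*-congˡ (X-top 0<e)) (zeroʳ _)) ⟩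
      1# ∎
      where
      step : ∀ f → - sgn f * X (e ℕ.+ f ℕ.* e) ≈ - X e * (sgn f * X (f ℕ.* e))
      step f = trans (*-congˡ (X-+ e (f ℕ.* e)))
        (solve 3 (λ s a b → (:- s) :* (a :* b) := (:- a) :* (s :* b)) refl (sgn f) (X e) (X (f ℕ.* e)))

    ratio : ℕ → ℕ → Carrier
    ratio n zero    = 1#
    ratio n (suc m) = ratio n m * ((1# - X (n ℕ.+ suc m)) * inv⁺ (n ℕ.+ suc m))

    0<n+suc : ∀ n m → 0 < n ℕ.+ suc m
    0<n+suc n m = ≡.subst (0 <_) (≡.sym (ℕ.+-suc n m)) (s≤s z≤n)

    ratio-last : ∀ n m → ratio n (suc m) * (1# + X (n ℕ.+ suc m)) ≈ ratio n m * (1# - X (n ℕ.+ suc m))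
    ratio-last n m = begin
      c * (Y * V) * (1# + x) ≈⟨ solve 4 (λ c y v p → c :* (y :* v) :* p := c :* y :* (p :* v)) refl c Y V (1# + x) ⟩
      c * Y * ((1# + x) * V) ≈⟨ *-congˡ (inv⁺-inverse (0<n+suc n m)) ⟩
      c * Y * 1#             ≈⟨ *-identityʳ _ ⟩
      c * Y                  ∎
      where
      c = ratio n m
      x = X (n ℕ.+ suc m)
      Y = 1# - x
      V = inv⁺ (n ℕ.+ suc m)

    -- `ratio` grows at its far end, so cancelling the denominator at the near end takes an
    -- induction on `m`. Together with `ratio-last` it removes either end factor of
    -- `ratio n (suc m)`.
    ratio-first : ∀ n m → ratio n (suc m) * (1# + X (suc n)) ≈ ratio (suc n) m * (1# - X (suc n))
    ratio-first n zero = ≡.subst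
      (λ j → 1# * ((1# - X j) * inv⁺ j) * (1# + X (suc n)) ≈ 1# * (1# - X (suc n)))
      (ℕ.+-comm 1 n)
      (begin
        1# * (Y * V) * P ≈⟨ solve 4 (λ o y v p → o :* (y :* v) :* p := o :* y :* (p :* v)) refl 1# Y V P ⟩
        1# * Y * (P * V) ≈⟨ *-congˡ (inv⁺-inverse (s≤s z≤n)) ⟩
        1# * Y * 1#      ≈⟨ *-identityʳ _ ⟩
        1# * Y           ∎)
      where
      Y = 1# - X (suc n)
      V = inv⁺ (suc n)
      P = 1# + X (suc n)
    ratio-first n (suc m) = begin
      ratio n (suc m) * F (n ℕ.+ suc (suc m)) * P  ≈⟨ swap _ _ _ ⟩
      ratio n (suc m) * P * F (n ℕ.+ suc (suc m))  ≈⟨ *-congʳ (ratio-first n m) ⟩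
      ratio (suc n) m * Y * F (n ℕ.+ suc (suc m))  ≈⟨ swap _ _ _ ⟩
      ratio (suc n) m * F (n ℕ.+ suc (suc m)) * Y
        ≈⟨ reflexive (≡.cong (λ j → ratio (suc n) m * F j * Y) (ℕ.+-suc n (suc m))) ⟩
      ratio (suc n) m * F (suc n ℕ.+ suc m) * Y    ∎
      where
      Y = 1# - X (suc n)
      P = 1# + X (suc n)
      F : ℕ → Carrier
      F j = (1# - X j) * inv⁺ j
      swap : ∀ a b c → a * b * c ≈ a * c * b
      swap = solve 3 (λ a b c → a :* b :* c := a :* c :* b) refl

    -- The series T and its recurrence

    module Theta (k : ℕ) where

      -- With `r` for k-i, these are the exponents at the indices n and -n-m-1 of the bilateral sum.
      -- Carrying both `i` and `r` keeps truncated subtraction out of the polynomial identities.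
      expA expB : ℕ → ℕ → ℕ → ℕ
      expA m r n = n ℕ.* (k ℕ.* n ℕ.+ r ℕ.+ k ℕ.* m)
      expB m i n = (n ℕ.+ suc m) ℕ.* (k ℕ.* n ℕ.+ i)

      -- At index -n-m-1 each of the m quotients changes sign, since (1-q^(-a))/(1+q^(-a)) =
      -- -(1-q^a)/(1+q^a). Together with (-1)^(n+m+1) this leaves minus the sign at index n, hence
      -- the difference of the two powers.
      term : ℕ → ℕ → ℕ → ℕ → Carrier
      term m i r n = sgn n * (ratio n m * (X (expA m r n) - X (expB m i n)))

      -- Up to the factor (-q)_∞/(q)_∞, and for i + r ≡ k, this is Andrews' H_{k,i}(-1/q; q^(m+1); q).
      T : ℕ → ℕ → ℕ → Carrier
      T m i r = Σ< D (term m i r)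

      module _ (m i r : ℕ) (k≡ : k ≡ suc (i ℕ.+ r)) where

        private
          -- Passing from (i, r+1) to (i+1, r) replaces A q^n - B by A - B q^(n+m+1), where A and B
          -- are the two powers in `term m (suc i) r n` and `term m i (suc r) n` respectively. The
          -- increment is A(1-q^n) + B(1-q^(n+m+1)), and `p` and `h` are its two halves.
          p h : ℕ → Carrier
          p n = sgn n * ratio n m * (X (expA m r n) * (1# - X n))
          h n = sgn n * ratio n m * (X (expB m i n) * (1# - X (n ℕ.+ suc m)))

          expA-suc : ∀ k n r m → n ℕ.* (k ℕ.* n ℕ.+ suc r ℕ.+ k ℕ.* m) ≡ n ℕ.* (k ℕ.* n ℕ.+ r ℕ.+ k ℕ.* m) ℕ.+ n
          expA-suc = solve-∀

          expB-suc : ∀ k n i m → (n ℕ.+ suc m) ℕ.* (k ℕ.* n ℕ.+ suc i) ≡ (n ℕ.+ suc m) ℕ.* (k ℕ.* n ℕ.+ i) ℕ.+ (n ℕ.+ suc m)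
          expB-suc = solve-∀

          lhs-term : ∀ n → term m (suc i) r n ≈ term m i (suc r) n + (p n + h n)
          lhs-term n = begin
            s * (c * (A - X (expB m (suc i) n)))
              ≈⟨ *-congˡ (*-congˡ (+-congˡ (-‿cong (X-split (expB-suc k n i m))))) ⟩
            s * (c * (A - B * Y))
              ≈⟨ solve 6 (λ s c A B N Y → s :* (c :* (A :- B :* Y)) :=
                   s :* (c :* (A :* N :- B)) :+ (s :* c :* (A :* (s :^ 0 :- N)) :+ s :* c :* (B :* (s :^ 0 :- Y))))
                   refl s c A B (X n) Y ⟩
            s * (c * (A * X n - B)) + (p n + h n)
              ≈⟨ +-congʳ (*-congˡ (*-congˡ (+-congʳ (X-split (expA-suc k n r m))))) ⟨
            term m i (suc r) n + (p n + h n) ∎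
            where
            s = sgn n
            c = ratio n m
            A = X (expA m r n)
            B = X (expB m i n)
            Y = X (n ℕ.+ suc m)

          -- The four exponents on the right of the recurrence, re-expressed through `expB` at n and
          -- `expA` at n+1, both for m. The first two hold for every k; `e₃` and `e₄` depend on k =
          -- i + r + 1.
          e₁ : ∀ k n m i → (n ℕ.+ suc m) ℕ.* (k ℕ.* n ℕ.+ i) ≡
               suc m ℕ.* i ℕ.+ n ℕ.* (k ℕ.* n ℕ.+ i ℕ.+ k ℕ.* suc m)
          e₁ = solve-∀

          e₂ : ∀ k n m i → (n ℕ.+ suc m) ℕ.* (k ℕ.* n ℕ.+ i) ℕ.+ (n ℕ.+ suc m) ≡
               suc m ℕ.* i ℕ.+ (suc m ℕ.+ n ℕ.* (k ℕ.* n ℕ.+ suc i ℕ.+ k ℕ.* suc m))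
          e₂ = solve-∀

          e₃ : ∀ n → suc n ℕ.* (k ℕ.* suc n ℕ.+ r ℕ.+ k ℕ.* m) ≡
               suc m ℕ.* i ℕ.+ (suc m ℕ.+ (n ℕ.+ suc (suc m)) ℕ.* (k ℕ.* n ℕ.+ r))
          e₃ n rewrite k≡ = eq i r n m
            where
            eq : ∀ i r n m → let k = suc (i ℕ.+ r) in
                 suc n ℕ.* (k ℕ.* suc n ℕ.+ r ℕ.+ k ℕ.* m) ≡
                 suc m ℕ.* i ℕ.+ (suc m ℕ.+ (n ℕ.+ suc (suc m)) ℕ.* (k ℕ.* n ℕ.+ r))
            eq = solve-∀

          e₄ : ∀ n → suc n ℕ.* (k ℕ.* suc n ℕ.+ r ℕ.+ k ℕ.* m) ℕ.+ suc n ≡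
               suc m ℕ.* i ℕ.+ (n ℕ.+ suc (suc m)) ℕ.* (k ℕ.* n ℕ.+ suc r)
          e₄ n rewrite k≡ = eq i r n m
            where
            eq : ∀ i r n m → let k = suc (i ℕ.+ r) in
                 suc n ℕ.* (k ℕ.* suc n ℕ.+ r ℕ.+ k ℕ.* m) ℕ.+ suc n ≡
                 suc m ℕ.* i ℕ.+ (n ℕ.+ suc (suc m)) ℕ.* (k ℕ.* n ℕ.+ suc r)
            eq = solve-∀

          X-join : ∀ {a b c d} → d ℕ.+ c ≡ a ℕ.+ b → X a * X b ≈ X d * X c
          X-join {a} {b} {c} {d} eq = trans (sym (X-+ a b)) (trans (X-≡ (≡.sym eq)) (X-+ d c))

          X-join₃ : ∀ {a b c d} → d ≡ a ℕ.+ (b ℕ.+ c) → X a * (X b * X c) ≈ X d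
          X-join₃ {a} {b} {c} eq = trans (*-congˡ (sym (X-+ b c))) (sym (X-split eq))

          -- The four powers combine as B(1 + q^(n+m+1)) - E(1 + q^(n+1)), and these two factors
          -- cancel the last and the first denominator of `ratio n (suc m)`. What remains belongs to
          -- index n for `h` but to n+1 for `p`.
          rhs-term : ∀ n → X (suc m ℕ.* i) * (term (suc m) (suc r) i n + X (suc m) * term (suc m) r (suc i) n)
                           ≈ h n + p (suc n)
          rhs-term n = begin
            M * (s * (c′ * (A₁ - B₁)) + x * (s * (c′ * (A₂ - B₂))))
              ≈⟨ solve 8 (λ M s c′ A₁ B₁ x A₂ B₂ →
                   M :* (s :* (c′ :* (A₁ :- B₁)) :+ x :* (s :* (c′ :* (A₂ :- B₂)))) :=
                   s :* (c′ :* ((M :* A₁ :- M :* B₁) :+ (M :* (x :* A₂) :- M :* (x :* B₂)))))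
                   refl M s c′ A₁ B₁ x A₂ B₂ ⟩
            s * (c′ * ((M * A₁ - M * B₁) + (M * (x * A₂) - M * (x * B₂))))
              ≈⟨ *-congˡ (*-congˡ (+-cong
                   (+-cong (sym (X-split (e₁ k n m i))) (-‿cong (X-join (e₄ n))))
                   (+-cong (trans (X-join₃ (e₂ k n m i)) (X-+ _ _)) (-‿cong (X-join₃ (e₃ n)))))) ⟩
            s * (c′ * ((B - E * S) + (B * Y - E)))
              ≈⟨ solve 6 (λ s c′ B E S Y → s :* (c′ :* ((B :- E :* S) :+ (B :* Y :- E))) :=
                   s :* B :* (c′ :* (s :^ 0 :+ Y)) :+ (:- s) :* E :* (c′ :* (s :^ 0 :+ S)))
                   refl s c′ B E S Y ⟩
            s * B * (c′ * (1# + Y)) + - s * E * (c′ * (1# + S))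
              ≈⟨ +-cong (*-congˡ (ratio-last n m)) (*-congˡ (ratio-first n m)) ⟩
            s * B * (c * (1# - Y)) + - s * E * (c⁺ * (1# - S))
              ≈⟨ solve 7 (λ s B c c⁺ E S Y →
                   s :* B :* (c :* (s :^ 0 :- Y)) :+ (:- s) :* E :* (c⁺ :* (s :^ 0 :- S)) :=
                   s :* c :* (B :* (s :^ 0 :- Y)) :+ (:- s) :* c⁺ :* (E :* (s :^ 0 :- S)))
                   refl s B c c⁺ E S Y ⟩
            h n + p (suc n) ∎
            where
            M  = X (suc m ℕ.* i)
            s  = sgn n
            x  = X (suc m)
            c  = ratio n m
            c′ = ratio n (suc m)
            c⁺ = ratio (suc n) m
            A₁ = X (expA (suc m) i n)
            B₁ = X (expB (suc m) (suc r) n)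
            A₂ = X (expA (suc m) (suc i) n)
            B₂ = X (expB (suc m) r n)
            B  = X (expB m i n)
            E  = X (expA m r (suc n))
            S  = X (suc n)
            Y  = X (n ℕ.+ suc m)

          p-0 : p 0 ≈ 0#
          p-0 = trans (*-congˡ (trans (*-congˡ (trans (+-congˡ (-‿cong X-0)) (-‿inverseʳ 1#))) (zeroʳ _))) (zeroʳ _)

          p-D : p D ≈ 0#
          p-D = trans (*-congˡ (trans (*-congʳ (X-high D≤)) (zeroˡ _))) (zeroʳ _)
            where
            D≤ : D ≤ expA m r D
            D≤ = ℕ.≤-trans (ℕ.≤-reflexive (≡.sym (ℕ.*-identityʳ D))) (ℕ.*-monoʳ-≤ D
              (ℕ.≤-trans (ℕ.*-mono-≤ (ℕ.≤-trans (s≤s z≤n) (ℕ.≤-reflexive (≡.sym k≡))) 0<D)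
                (ℕ.≤-trans (ℕ.m≤m+n (k ℕ.* D) r) (ℕ.m≤m+n _ (k ℕ.* m)))))

          -- Both boundary terms vanish, `p 0` through 1 - q^0 and `p D` by truncation. The shift
          -- supplies the `p (suc n)` that `rhs-term` pairs with `h n`.
          p-shift : Σ< D p ≈ Σ< D (p ∘ suc)
          p-shift = begin
            Σ< D p                 ≈⟨ +-identityʳ _ ⟨
            Σ< D p + 0#            ≈⟨ +-congˡ p-D ⟨
            Σ< (suc D) p           ≈⟨ Σ<-head D p ⟩
            p 0 + Σ< D (p ∘ suc)   ≈⟨ +-congʳ p-0 ⟩
            0# + Σ< D (p ∘ suc)    ≈⟨ +-identityˡ _ ⟩
            Σ< D (p ∘ suc)         ∎

        T-rec : T m (suc i) r ≈
                T m i (suc r) + X (suc m ℕ.* i) * (T (suc m) (suc r) i + X (suc m) * T (suc m) r (suc i))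
        T-rec = begin
          T m (suc i) r                                    ≈⟨ Σ<-cong D (λ n _ → lhs-term n) ⟩
          Σ< D (λ n → term m i (suc r) n + (p n + h n))    ≈⟨ Σ<-+ D _ _ ⟩
          T m i (suc r) + Σ< D (λ n → p n + h n)           ≈⟨ +-congˡ (trans (Σ<-+ D p h) (+-congʳ p-shift)) ⟩
          T m i (suc r) + (Σ< D (p ∘ suc) + Σ< D h)        ≈⟨ +-congˡ (trans (+-comm _ _) (sym (Σ<-+ D h (p ∘ suc)))) ⟩
          T m i (suc r) + Σ< D (λ n → h n + p (suc n))     ≈⟨ +-congˡ (Σ<-cong D (λ n _ → rhs-term n)) ⟨
          T m i (suc r) + Σ< D (λ n → X (suc m ℕ.* i) * (term (suc m) (suc r) i n + X (suc m) * term (suc m) r (suc i) n))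
            ≈⟨ +-congˡ (trans (Σ<-*ˡ D _ _) (*-congˡ (trans (Σ<-+ D _ _) (+-congˡ (Σ<-*ˡ D _ _))))) ⟩
          T m i (suc r) + X (suc m ℕ.* i) * (T (suc m) (suc r) i + X (suc m) * T (suc m) r (suc i)) ∎

      -- For i = 0 the reflection preserves the exponent and reverses the sign, so each folded term
      -- cancels itself.
      T-zero : ∀ m {r} → k ≡ r → T m 0 r ≈ 0#
      T-zero m ≡.refl = Σ<-zero D λ n _ → trans
        (*-congˡ (trans (*-congˡ (trans (+-congˡ (-‿cong (X-≡ (eq k m n)))) (-‿inverseʳ _))) (zeroʳ _)))
        (zeroʳ _)
        where
        eq : ∀ k m n → (n ℕ.+ suc m) ℕ.* (k ℕ.* n ℕ.+ 0) ≡ n ℕ.* (k ℕ.* n ℕ.+ k ℕ.+ k ℕ.* m)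
        eq = solve-∀

      -- `T-rec` iterated down to `T-zero`. The summand at `f` accounts for `f` plain parts m+1,
      -- without and with an overlined m+1.
      T-telescope : ∀ m i r → i ℕ.+ r ≡ k → T m i r ≈ Σ< i (λ f →
        X (suc m ℕ.* f) * (T (suc m) (k ℕ.∸ f) f + X (suc m) * T (suc m) (k ℕ.∸ suc f) (suc f)))
      T-telescope m zero    r eq = T-zero m (≡.sym eq)
      T-telescope m (suc i) r eq = trans (T-rec m i r (≡.sym eq))
        (+-cong (T-telescope m i (suc r) (≡.trans (ℕ.+-suc i r) eq))
          (reflexive (≡.cong₂ (λ a b → X (suc m ℕ.* i) * (T (suc m) a i + X (suc m) * T (suc m) b (suc i)))
            (≡.sym k∸i) (≡.sym k∸1+i))))
        where
        k∸i : k ℕ.∸ i ≡ suc r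
        k∸i = ≡.trans (≡.cong (ℕ._∸ i) (≡.sym (≡.trans (ℕ.+-suc i r) eq))) (ℕ.m+n∸m≡n i (suc r))
        k∸1+i : k ℕ.∸ suc i ≡ r
        k∸1+i = ≡.trans (≡.cong (ℕ._∸ suc i) (≡.sym eq)) (ℕ.m+n∸m≡n (suc i) r)

      -- Only q^0 at n = 0 survives: `expA` is at least km for n > 0, and `expB` is at least m+1
      -- because the index `suc i` is positive. At index 0 the series would vanish instead.
      T-limit : ∀ m i r → D ≤ m → 0 < k → T m (suc i) r ≈ ratio 0 m
      T-limit m i r D≤m 0<k = begin
        T m (suc i) r                               ≈⟨ reflexive (≡.cong (λ d → Σ< d (term m (suc i) r)) D≡) ⟩
        Σ< (suc (ℕ.pred D)) (term m (suc i) r)      ≈⟨ Σ<-head (ℕ.pred D) _ ⟩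
        term m (suc i) r 0 + Σ< (ℕ.pred D) (term m (suc i) r ∘ suc)
          ≈⟨ +-cong first (Σ<-zero (ℕ.pred D) (λ n _ → later n)) ⟩
        ratio 0 m + 0#                              ≈⟨ +-identityʳ _ ⟩
        ratio 0 m                                   ∎
        where
        D≡ : D ≡ suc (ℕ.pred D)
        D≡ = ≡.sym (ℕ.suc-pred D {{ℕ.>-nonZero 0<D}})
        expB-high : ∀ n → X (expB m (suc i) n) ≈ 0#
        expB-high n = X-high (ℕ.≤-trans D≤m (ℕ.≤-trans (ℕ.n≤1+n m) (ℕ.≤-trans (ℕ.m≤n+m (suc m) n)
          (ℕ.≤-trans (ℕ.≤-reflexive (≡.sym (ℕ.*-identityʳ _)))
            (ℕ.*-monoʳ-≤ (n ℕ.+ suc m) (0<n+suc (k ℕ.* n) i))))))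
        first : term m (suc i) r 0 ≈ ratio 0 m
        first = begin
          1# * (ratio 0 m * (X 0 - X (expB m (suc i) 0)))
            ≈⟨ trans (*-identityˡ _) (*-congˡ (trans (+-congʳ X-0) (1-0 (expB-high 0)))) ⟩
          ratio 0 m * 1# ≈⟨ *-identityʳ _ ⟩
          ratio 0 m ∎
        later : ∀ n → term m (suc i) r (suc n) ≈ 0#
        later n = trans (*-congˡ (trans (*-congˡ (trans
          (+-cong (X-high D≤) (trans (-‿cong (expB-high (suc n))) -0#≈0#)) (+-identityʳ 0#))) (zeroʳ _))) (zeroʳ _)
          where
          D≤ : D ≤ expA m r (suc n)
          D≤ = ℕ.≤-trans D≤m (ℕ.≤-trans (ℕ.≤-trans
            (ℕ.≤-trans (ℕ.≤-reflexive (≡.sym (ℕ.*-identityˡ m))) (ℕ.*-monoˡ-≤ m 0<k))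
            (ℕ.m≤n+m (k ℕ.* m) (k ℕ.* suc n ℕ.+ r))) (ℕ.m≤m+n _ _))

      -- The Jacobi triple product in base q^(2k)

      private
        w : ℕ
        w = 2 ℕ.* k

      y : ℕ → ℕ → Carrier
      y c zero    = 1#
      y c (suc s) = - X (c ℕ.+ w ℕ.* s) * y c s

      y-shift : ∀ c s → y (c ℕ.+ w) s ≈ X (w ℕ.* s) * y c s
      y-shift c zero    = sym (trans (*-congʳ (trans (X-≡ (ℕ.*-zeroʳ w)) X-0)) (*-identityʳ 1#))
      y-shift c (suc s) = begin
        - X (c ℕ.+ w ℕ.+ w ℕ.* s) * y (c ℕ.+ w) s          ≈⟨ *-cong (-‿cong (X-split (eq c w s))) (y-shift c s) ⟩
        - (X w * X (c ℕ.+ w ℕ.* s)) * (X (w ℕ.* s) * y c s)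
          ≈⟨ solve 4 (λ a b c d → (:- (a :* b)) :* (c :* d) := a :* c :* ((:- b) :* d)) refl _ _ _ _ ⟩
        X w * X (w ℕ.* s) * y c (suc s)                     ≈⟨ *-congʳ (X-split (ℕ.*-suc w s)) ⟨
        X (w ℕ.* suc s) * y c (suc s)                       ∎
        where
        eq : ∀ c w s → c ℕ.+ w ℕ.+ w ℕ.* s ≡ w ℕ.+ (c ℕ.+ w ℕ.* s)
        eq = solve-∀

      y-suc : ∀ c s → y c (suc s) ≈ - X c * y (c ℕ.+ w) s
      y-suc c s = begin
        - X (c ℕ.+ w ℕ.* s) * y c s         ≈⟨ *-congʳ (-‿cong (X-+ c (w ℕ.* s))) ⟩
        - (X c * X (w ℕ.* s)) * y c s       ≈⟨ solve 3 (λ a b c → (:- (a :* b)) :* c := (:- a) :* (b :* c)) refl _ _ _ ⟩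
        - X c * (X (w ℕ.* s) * y c s)       ≈⟨ *-congˡ (y-shift c s) ⟨
        - X c * y (c ℕ.+ w) s               ∎

      private
        -- Each of the `s` factors has exponent at least 1 when the parameter is positive. Hence the
        -- terms from s = D on are zero.
        X-∣-y : ∀ c s → ∃[ h ] y (suc c) s ≈ X s * h
        X-∣-y c zero    = 1# , sym (trans (*-congʳ X-0) (*-identityʳ 1#))
        X-∣-y c (suc s) with X-∣-y c s
        ... | h , eq = - X (c ℕ.+ w ℕ.* s) * h , (begin
          - X (1 ℕ.+ (c ℕ.+ w ℕ.* s)) * y (suc c) s    ≈⟨ *-cong (-‿cong (X-+ 1 _)) eq ⟩
          - (X 1 * X (c ℕ.+ w ℕ.* s)) * (X s * h)
            ≈⟨ solve 4 (λ a b c d → (:- (a :* b)) :* (c :* d) := a :* c :* ((:- b) :* d)) refl _ _ _ _ ⟩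
          X 1 * X s * (- X (c ℕ.+ w ℕ.* s) * h)        ≈⟨ *-congʳ (X-+ 1 s) ⟨
          X (suc s) * (- X (c ℕ.+ w ℕ.* s) * h)        ∎)

      y-high : ∀ {c s} → 0 < c → D ≤ s → y c s ≈ 0#
      y-high {suc c} {s} _ D≤s with X-∣-y c s
      ... | h , eq = trans eq (trans (*-congʳ (X-high D≤s)) (zeroˡ h))

      y-high′ : ∀ {c} s → D ≤ c → y c (suc s) ≈ 0#
      y-high′ {c} s D≤c = trans (*-congʳ (trans (-‿cong (X-high (ℕ.≤-trans D≤c (ℕ.m≤m+n c _)))) -0#≈0#)) (zeroˡ _)

      module Jacobi (0<k : 0 < k) where

        private
          0<w : 0 < w
          0<w = ℕ.≤-trans 0<k (ℕ.m≤m+n k _)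

          0<w*suc : ∀ s → 0 < w ℕ.* suc s
          0<w*suc s = ℕ.*-mono-≤ 0<w (s≤s z≤n)

          -- One more than the `D` terms that can be nonzero: after the head of a sum is removed in
          -- `E-rec`, the zero term at s = D restores the original range.
          K : ℕ
          K = suc D

        -- The reciprocal of the finite product (1-q^w)(1-q^(2w))...(1-q^(sw)).
        u : ℕ → Carrier
        u zero    = 1#
        u (suc s) = u s * inv⁻ (w ℕ.* suc s)

        u-suc : ∀ s → (1# - X (w ℕ.* suc s)) * u (suc s) ≈ u s
        u-suc s = begin
          Y * (u s * V)  ≈⟨ solve 3 (λ a b c → a :* (b :* c) := b :* (a :* c)) refl Y (u s) V ⟩
          u s * (Y * V)  ≈⟨ *-congˡ (inv⁻-inverse (0<w*suc s)) ⟩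
          u s * 1#       ≈⟨ *-identityʳ _ ⟩
          u s            ∎
          where
          Y = 1# - X (w ℕ.* suc s)
          V = inv⁻ (w ℕ.* suc s)

        u-inverse : ∀ s → Π< s (λ l → 1# - X (w ℕ.* suc l)) * u s ≈ 1#
        u-inverse zero    = *-identityʳ 1#
        u-inverse (suc s) = trans (*-assoc _ _ _) (trans (*-congˡ (u-suc s)) (u-inverse s))

        w*-high : ∀ {s} → D ≤ s → X (w ℕ.* suc s) ≈ 0#
        w*-high {s} D≤s = X-high (ℕ.≤-trans D≤s (ℕ.≤-trans (ℕ.n≤1+n s)
          (ℕ.≤-trans (ℕ.≤-reflexive (≡.sym (ℕ.*-identityˡ (suc s)))) (ℕ.*-monoˡ-≤ (suc s) 0<w))))

        u-stable : ∀ m → u (m ℕ.+ D) ≈ u D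
        u-stable zero    = refl
        u-stable (suc m) = begin
          u (suc (m ℕ.+ D))   ≈⟨ *-identityˡ _ ⟨
          1# * u (suc (m ℕ.+ D)) ≈⟨ *-congʳ (1-0 (w*-high (ℕ.m≤n+m D m))) ⟨
          (1# - X (w ℕ.* suc (m ℕ.+ D))) * u (suc (m ℕ.+ D)) ≈⟨ u-suc (m ℕ.+ D) ⟩
          u (m ℕ.+ D)         ≈⟨ u-stable m ⟩
          u D                 ∎

        -- Euler's series for the infinite product of the factors 1 - q^(c+wl), l ≥ 0.
        E : ℕ → Carrier
        E c = Σ< K (λ s → y c s * u s)

        -- Write 1 = q^(ws) + (1 - q^(ws)) in each term. The first part moves `c` to `c + w`; in the
        -- second the factor cancels the last denominator of `u s`, and the sum reindexes to -q^c
        -- times the same series.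
        E-rec : ∀ {c} → 0 < c → E c ≈ (1# - X c) * E (c ℕ.+ w)
        E-rec {c} 0<c = begin
          E c ≈⟨ Σ<-cong K (λ s _ → split s) ⟩
          Σ< K (λ s → y (c ℕ.+ w) s * u s + d s) ≈⟨ Σ<-+ K _ d ⟩
          E (c ℕ.+ w) + Σ< K d ≈⟨ +-congˡ Σd ⟩
          E (c ℕ.+ w) + - X c * E (c ℕ.+ w)
            ≈⟨ solve 2 (λ e x → e :+ (:- x) :* e := (x :^ 0 :- x) :* e) refl (E (c ℕ.+ w)) (X c) ⟩
          (1# - X c) * E (c ℕ.+ w) ∎
          where
          d : ℕ → Carrier
          d s = y c s * ((1# - X (w ℕ.* s)) * u s)

          split : ∀ s → y c s * u s ≈ y (c ℕ.+ w) s * u s + d s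
          split s = trans
            (solve 3 (λ y x u → y :* u := x :* y :* u :+ y :* ((x :^ 0 :- x) :* u)) refl (y c s) (X (w ℕ.* s)) (u s))
            (+-congʳ (*-congʳ (sym (y-shift c s))))

          d-0 : d 0 ≈ 0#
          d-0 = trans (*-congˡ (trans (*-congʳ (trans (+-congˡ (-‿cong
            (trans (X-≡ (ℕ.*-zeroʳ w)) X-0))) (-‿inverseʳ 1#))) (zeroˡ _))) (zeroʳ _)

          d-suc : ∀ s → d (suc s) ≈ - X c * (y (c ℕ.+ w) s * u s)
          d-suc s = trans (*-cong (y-suc c s) (u-suc s)) (*-assoc _ _ _)

          last-0 : y (c ℕ.+ w) D * u D ≈ 0#
          last-0 = trans (*-congʳ (y-high (ℕ.≤-trans 0<c (ℕ.m≤m+n c w)) ℕ.≤-refl)) (zeroˡ _)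

          Σd : Σ< K d ≈ - X c * E (c ℕ.+ w)
          Σd = begin
            Σ< K d                     ≈⟨ Σ<-head D d ⟩
            d 0 + Σ< D (d ∘ suc)       ≈⟨ +-cong d-0 (Σ<-cong D (λ s _ → d-suc s)) ⟩
            0# + Σ< D (λ s → - X c * (y (c ℕ.+ w) s * u s)) ≈⟨ trans (+-identityˡ _) (Σ<-*ˡ D _ _) ⟩
            - X c * Σ< D (λ s → y (c ℕ.+ w) s * u s)
              ≈⟨ *-congˡ (trans (+-congˡ last-0) (+-identityʳ _)) ⟨
            - X c * E (c ℕ.+ w)        ∎

        E-prod : ∀ L {c} → 0 < c → E c ≈ Π< L (λ l → 1# - X (c ℕ.+ w ℕ.* l)) * E (c ℕ.+ w ℕ.* L)
        E-prod zero    {c} 0<c = sym (trans (*-identityˡ _)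
          (reflexive (≡.cong E (≡.trans (≡.cong (c ℕ.+_) (ℕ.*-zeroʳ w)) (ℕ.+-identityʳ c)))))
        E-prod (suc L) {c} 0<c = trans (E-prod L 0<c) (trans (*-congˡ (trans
          (E-rec (ℕ.≤-trans 0<c (ℕ.m≤m+n c _)))
          (*-congˡ (reflexive (≡.cong E (eq c w L)))))) (sym (*-assoc _ _ _)))
          where
          eq : ∀ c w L → c ℕ.+ w ℕ.* L ℕ.+ w ≡ c ℕ.+ w ℕ.* suc L
          eq = solve-∀

        E-limit : ∀ {c} → D ≤ c → E c ≈ 1#
        E-limit {c} D≤c = begin
          E c ≈⟨ Σ<-head D _ ⟩
          1# * 1# + Σ< D (λ s → y c (suc s) * u (suc s))
            ≈⟨ +-cong (*-identityʳ 1#) (Σ<-zero D (λ s _ → trans (*-congʳ (y-high′ s D≤c)) (zeroˡ _))) ⟩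
          1# + 0# ≈⟨ +-identityʳ 1# ⟩
          1# ∎

        module _ (e e′ : ℕ) (0<e : 0 < e) (0<e′ : 0 < e′) (e+e′ : e ℕ.+ e′ ≡ w) where

          -- t A s is the theta term of index A - s, a possibly negative integer.
          t : ℕ → ℕ → Carrier
          t zero    s       = y e′ s
          t (suc A) zero    = y e (suc A)
          t (suc A) (suc s) = t A s

          t-zeroʳ : ∀ A → t A 0 ≈ y e A
          t-zeroʳ zero    = refl
          t-zeroʳ (suc A) = refl

          -- Consecutive theta terms at index A-s have quotient -q^(e+w(A-s)). Multiplying by q^(ws)
          -- keeps the exponent nonnegative; crossing index 0 uses e + e′ = w.
          t-up : ∀ A s → X (w ℕ.* s) * t (suc A) s ≈ - X (e ℕ.+ w ℕ.* A) * t A s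
          t-up A zero = trans (*-congʳ (trans (X-≡ (ℕ.*-zeroʳ w)) X-0)) (trans (*-identityˡ _) (*-congˡ (sym (t-zeroʳ A))))
          t-up zero (suc s) = begin
            X (w ℕ.* suc s) * y e′ s ≈⟨ *-congʳ (X-split eq) ⟩
            X (e ℕ.+ w ℕ.* 0) * X (e′ ℕ.+ w ℕ.* s) * y e′ s
              ≈⟨ solve 3 (λ a b c → a :* b :* c := (:- a) :* ((:- b) :* c)) refl _ _ _ ⟩
            - X (e ℕ.+ w ℕ.* 0) * (- X (e′ ℕ.+ w ℕ.* s) * y e′ s) ∎
            where
            eq′ : ∀ e e′ w s → (e ℕ.+ e′) ℕ.+ w ℕ.* s ≡ e ℕ.+ w ℕ.* 0 ℕ.+ (e′ ℕ.+ w ℕ.* s)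
            eq′ = solve-∀
            eq : w ℕ.* suc s ≡ e ℕ.+ w ℕ.* 0 ℕ.+ (e′ ℕ.+ w ℕ.* s)
            eq = ≡.trans (ℕ.*-suc w s) (≡.trans (≡.cong (ℕ._+ w ℕ.* s) (≡.sym e+e′)) (eq′ e e′ w s))
          t-up (suc A) (suc s) = begin
            X (w ℕ.* suc s) * t (suc A) s          ≈⟨ *-congʳ (X-split (ℕ.*-suc w s)) ⟩
            X w * X (w ℕ.* s) * t (suc A) s        ≈⟨ *-assoc _ _ _ ⟩
            X w * (X (w ℕ.* s) * t (suc A) s)      ≈⟨ *-congˡ (t-up A s) ⟩
            X w * (- X (e ℕ.+ w ℕ.* A) * t A s)    ≈⟨ solve 3 (λ a b c → a :* ((:- b) :* c) := (:- (a :* b)) :* c) refl _ _ _ ⟩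
            - (X w * X (e ℕ.+ w ℕ.* A)) * t A s    ≈⟨ *-congʳ (-‿cong (X-split (eq e w A))) ⟨
            - X (e ℕ.+ w ℕ.* suc A) * t A s        ∎
            where
            eq : ∀ e w A → e ℕ.+ w ℕ.* suc A ≡ w ℕ.+ (e ℕ.+ w ℕ.* A)
            eq = solve-∀

          t-diag : ∀ A d → t A (A ℕ.+ d) ≈ y e′ d
          t-diag zero    d = refl
          t-diag (suc A) d = t-diag A d

          t-diag′ : ∀ s d → t (s ℕ.+ d) s ≈ y e d
          t-diag′ zero    d = t-zeroʳ d
          t-diag′ (suc s) d = t-diag′ s d

          -- Interpolates between a product and the theta series: at A = 0 it is Euler's series
          -- `E e′`, while for large A the weights `u s` are constant wherever the theta term is
          -- nonzero.
          Φ : ℕ → Carrier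
          Φ A = Σ< (A ℕ.+ K) (λ s → t A s * u s)

          -- The same splitting of 1 as in `E-rec`: the q^(ws) part goes down by `t-up`, and the
          -- other part reindexes to `Φ A` because `t (suc A) (suc s)` is `t A s`.
          Φ-rec : ∀ A → Φ (suc A) ≈ Φ A * (1# - X (e ℕ.+ w ℕ.* A))
          Φ-rec A = begin
            Σ< S (λ s → t (suc A) s * u s) ≈⟨ Σ<-cong S (λ s _ → split s) ⟩
            Σ< S (λ s → - X (e ℕ.+ w ℕ.* A) * (t A s * u s) + d s) ≈⟨ trans (Σ<-+ S _ d) (+-congʳ (Σ<-*ˡ S _ _)) ⟩
            - X (e ℕ.+ w ℕ.* A) * Σ< S (λ s → t A s * u s) + Σ< S d ≈⟨ +-cong (*-congˡ (trans (+-congˡ last-0) (+-identityʳ _))) Σd ⟩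
            - X (e ℕ.+ w ℕ.* A) * Φ A + Φ A
              ≈⟨ solve 2 (λ e x → (:- x) :* e :+ e := e :* (x :^ 0 :- x)) refl (Φ A) _ ⟩
            Φ A * (1# - X (e ℕ.+ w ℕ.* A)) ∎
            where
            S = suc A ℕ.+ K
            d : ℕ → Carrier
            d s = t (suc A) s * ((1# - X (w ℕ.* s)) * u s)

            split : ∀ s → t (suc A) s * u s ≈ - X (e ℕ.+ w ℕ.* A) * (t A s * u s) + d s
            split s = trans
              (solve 3 (λ y x u → y :* u := x :* y :* u :+ y :* ((x :^ 0 :- x) :* u)) refl (t (suc A) s) (X (w ℕ.* s)) (u s))
              (+-congʳ (trans (*-congʳ (t-up A s)) (*-assoc _ _ _)))

            d-0 : d 0 ≈ 0#
            d-0 = trans (*-congˡ (trans (*-congʳ (trans (+-congˡ (-‿cong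
              (trans (X-≡ (ℕ.*-zeroʳ w)) X-0))) (-‿inverseʳ 1#))) (zeroˡ _))) (zeroʳ _)

            last-0 : t A (A ℕ.+ K) * u (A ℕ.+ K) ≈ 0#
            last-0 = trans (*-congʳ (trans (t-diag A K) (y-high 0<e′ (ℕ.n≤1+n D)))) (zeroˡ _)

            Σd : Σ< S d ≈ Φ A
            Σd = begin
              Σ< S d                         ≈⟨ Σ<-head (A ℕ.+ K) d ⟩
              d 0 + Σ< (A ℕ.+ K) (d ∘ suc)   ≈⟨ +-cong d-0 (Σ<-cong (A ℕ.+ K) (λ s _ → *-congˡ (u-suc s))) ⟩
              0# + Φ A                       ≈⟨ +-identityˡ _ ⟩
              Φ A                            ∎

          Φ-prod : ∀ A → Φ A ≈ E e′ * Π< A (λ l → 1# - X (e ℕ.+ w ℕ.* l))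
          Φ-prod zero    = sym (*-identityʳ _)
          Φ-prod (suc A) = trans (Φ-rec A) (trans (*-congʳ (Φ-prod A)) (*-assoc _ _ _))

          Σt : ∀ A → Σ< (A ℕ.+ K) (t A) ≈ Σ< A (y e ∘ suc) + Σ< K (y e′)
          Σt zero    = sym (+-identityˡ _)
          Σt (suc A) = begin
            Σ< (suc A ℕ.+ K) (t (suc A))                     ≈⟨ Σ<-head (A ℕ.+ K) _ ⟩
            y e (suc A) + Σ< (A ℕ.+ K) (t A)                 ≈⟨ +-congˡ (Σt A) ⟩
            y e (suc A) + (Σ< A (y e ∘ suc) + Σ< K (y e′))
              ≈⟨ solve 3 (λ a b c → a :+ (b :+ c) := b :+ a :+ c) refl _ _ _ ⟩
            Σ< (suc A) (y e ∘ suc) + Σ< K (y e′)             ∎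

          θ : Carrier
          θ = Σ< D (λ n → y e n + y e′ (suc n))

          Σt-θ : Σ< (D ℕ.+ D ℕ.+ K) (t (D ℕ.+ D)) ≈ θ
          Σt-θ = begin
            Σ< (D ℕ.+ D ℕ.+ K) (t (D ℕ.+ D))                       ≈⟨ Σt (D ℕ.+ D) ⟩
            Σ< (D ℕ.+ D) (y e ∘ suc) + Σ< K (y e′)                 ≈⟨ +-congˡ (Σ<-head D (y e′)) ⟩
            Σ< (D ℕ.+ D) (y e ∘ suc) + (1# + Σ< D (y e′ ∘ suc))
              ≈⟨ solve 3 (λ a b c → a :+ (b :+ c) := (b :+ a) :+ c) refl _ _ _ ⟩
            (1# + Σ< (D ℕ.+ D) (y e ∘ suc)) + Σ< D (y e′ ∘ suc)    ≈⟨ +-congʳ (Σ<-head (D ℕ.+ D) (y e)) ⟨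
            Σ< (suc D ℕ.+ D) (y e) + Σ< D (y e′ ∘ suc)             ≈⟨ +-congʳ (Σ<-trim (suc D) D (λ _ → y-high 0<e)) ⟩
            Σ< D (y e) + Σ< D (y e′ ∘ suc)                         ≈⟨ Σ<-+ D _ _ ⟨
            θ                                                      ∎

          -- With A = 2D, a term with s ≤ D has index at least D and vanishes, and for s ≥ D the
          -- weight has stabilised at `u D`.
          Φ-θ : Φ (D ℕ.+ D) ≈ u D * θ
          Φ-θ = begin
            Φ (D ℕ.+ D) ≈⟨ Σ<-cong S (λ s _ → step s) ⟩
            Σ< S (λ s → u D * t (D ℕ.+ D) s) ≈⟨ Σ<-*ˡ S (u D) _ ⟩
            u D * Σ< S (t (D ℕ.+ D))         ≈⟨ *-congˡ Σt-θ ⟩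
            u D * θ                          ∎
            where
            S = D ℕ.+ D ℕ.+ K
            t-low : ∀ s → s ≤ D → t (D ℕ.+ D) s ≈ 0#
            t-low s s≤D = ≡.subst (λ A → t A s ≈ 0#) (ℕ.m+[n∸m]≡n (ℕ.≤-trans s≤D (ℕ.m≤m+n D D)))
              (trans (t-diag′ s _) (y-high 0<e (ℕ.≤-trans (ℕ.≤-reflexive (≡.sym (ℕ.m+n∸n≡m D D)))
                (ℕ.∸-monoʳ-≤ (D ℕ.+ D) s≤D))))
            step : ∀ s → t (D ℕ.+ D) s * u s ≈ u D * t (D ℕ.+ D) s
            step s with ℕ.≤-total s D
            ... | inj₁ s≤D = trans (trans (*-congʳ (t-low s s≤D)) (zeroˡ _))
                    (sym (trans (*-congˡ (t-low s s≤D)) (zeroʳ _)))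
            ... | inj₂ D≤s = trans (*-congˡ (trans (reflexive (≡.cong u (≡.sym (ℕ.m∸n+n≡m D≤s)))) (u-stable (s ℕ.∸ D))))
                    (*-comm _ _)

          -- Two evaluations of Φ at 2D, by `Φ-θ` and by `Φ-prod`, are compared; the factor `u D` is
          -- cleared by the product it inverts, whose factors beyond the first D are 1.
          jacobi : θ ≈ Π< (D ℕ.+ D) (λ l → (1# - X (w ℕ.* suc l)) * ((1# - X (e′ ℕ.+ w ℕ.* l)) * (1# - X (e ℕ.+ w ℕ.* l))))
          jacobi = begin
            θ ≈⟨ *-identityˡ _ ⟨
            1# * θ ≈⟨ *-congʳ (u-inverse D) ⟨
            P₀ D * u D * θ ≈⟨ *-assoc _ _ _ ⟩
            P₀ D * (u D * θ) ≈⟨ *-cong (sym (Π<-trim D D (λ l D≤l → 1-0 (w*-high D≤l)))) (sym Φ-θ) ⟩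
            P₀ N * Φ N ≈⟨ *-congˡ (Φ-prod N) ⟩
            P₀ N * (E e′ * P₂) ≈⟨ *-congˡ (*-congʳ (trans (E-prod N 0<e′) (trans (*-congˡ (E-limit big)) (*-identityʳ _)))) ⟩
            P₀ N * (P₁ * P₂) ≈⟨ *-congˡ (Π<-* N _ _) ⟨
            P₀ N * Π< N (λ l → (1# - X (e′ ℕ.+ w ℕ.* l)) * (1# - X (e ℕ.+ w ℕ.* l))) ≈⟨ Π<-* N _ _ ⟨
            Π< N (λ l → (1# - X (w ℕ.* suc l)) * ((1# - X (e′ ℕ.+ w ℕ.* l)) * (1# - X (e ℕ.+ w ℕ.* l)))) ∎
            where
            N = D ℕ.+ D
            P₀ : ℕ → Carrier
            P₀ n = Π< n (λ l → 1# - X (w ℕ.* suc l))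
            P₁ = Π< N (λ l → 1# - X (e′ ℕ.+ w ℕ.* l))
            P₂ = Π< N (λ l → 1# - X (e ℕ.+ w ℕ.* l))
            big : D ≤ e′ ℕ.+ w ℕ.* N
            big = ℕ.≤-trans (ℕ.m≤m+n D D) (ℕ.≤-trans (ℕ.≤-trans (ℕ.≤-reflexive (≡.sym (ℕ.*-identityˡ N)))
              (ℕ.*-monoˡ-≤ N 0<w)) (ℕ.m≤n+m (w ℕ.* N) e′))

        module _ (i r : ℕ) (i+r≡k : i ℕ.+ r ≡ k) (0<i : 0 < i) where

          private
            y-closed : ∀ n → y (k ℕ.+ r) n ≈ sgn n * X (expA 0 r n)
            y-closed zero    = sym (trans (*-identityˡ _) X-0)
            y-closed (suc n) = begin
              - X (k ℕ.+ r ℕ.+ w ℕ.* n) * y (k ℕ.+ r) n ≈⟨ *-congˡ (y-closed n) ⟩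
              - X (k ℕ.+ r ℕ.+ w ℕ.* n) * (sgn n * X (expA 0 r n))
                ≈⟨ solve 3 (λ a b c → (:- a) :* (b :* c) := (:- b) :* (a :* c)) refl _ _ _ ⟩
              - sgn n * (X (k ℕ.+ r ℕ.+ w ℕ.* n) * X (expA 0 r n)) ≈⟨ *-congˡ (X-split (eq k r n)) ⟨
              - sgn n * X (expA 0 r (suc n)) ∎
              where
              eq : ∀ k r n → suc n ℕ.* (k ℕ.* suc n ℕ.+ r ℕ.+ k ℕ.* 0) ≡
                   k ℕ.+ r ℕ.+ 2 ℕ.* k ℕ.* n ℕ.+ n ℕ.* (k ℕ.* n ℕ.+ r ℕ.+ k ℕ.* 0)
              eq = solve-∀

            y-closed′ : ∀ n → y i (suc n) ≈ - sgn n * X (expB 0 i n)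
            y-closed′ zero = trans (*-identityʳ _) (trans (-‿cong (X-≡ (eq k i)))
              (solve 1 (λ x → :- x := (:- (x :^ 0)) :* x) refl _))
              where
              eq : ∀ k i → i ℕ.+ 2 ℕ.* k ℕ.* 0 ≡ (0 ℕ.+ 1) ℕ.* (k ℕ.* 0 ℕ.+ i)
              eq = solve-∀
            y-closed′ (suc n) = begin
              - X (i ℕ.+ w ℕ.* suc n) * y i (suc n) ≈⟨ *-congˡ (y-closed′ n) ⟩
              - X (i ℕ.+ w ℕ.* suc n) * (- sgn n * X (expB 0 i n))
                ≈⟨ solve 3 (λ a b c → (:- a) :* (b :* c) := (:- b) :* (a :* c)) refl _ _ _ ⟩
              - - sgn n * (X (i ℕ.+ w ℕ.* suc n) * X (expB 0 i n)) ≈⟨ *-congˡ (X-split (eq k i n)) ⟨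
              - - sgn n * X (expB 0 i (suc n)) ∎
              where
              eq : ∀ k i n → (suc n ℕ.+ 1) ℕ.* (k ℕ.* suc n ℕ.+ i) ≡
                   i ℕ.+ 2 ℕ.* k ℕ.* suc n ℕ.+ (n ℕ.+ 1) ℕ.* (k ℕ.* n ℕ.+ i)
              eq = solve-∀

            e+e′ : k ℕ.+ r ℕ.+ i ≡ w
            e+e′ = ≡.trans (ℕ.+-assoc k r i) (≡.cong (k ℕ.+_) (≡.trans (ℕ.+-comm r i)
              (≡.trans i+r≡k (≡.sym (ℕ.+-identityʳ k)))))

          -- At m = 0 the quotients are empty and T is a plain theta series in base q^(2k). Its
          -- parameters are i and k + r = 2k - i.
          T-product : T 0 i r ≈ Π< (D ℕ.+ D) (λ l →
            (1# - X (w ℕ.* suc l)) * ((1# - X (i ℕ.+ w ℕ.* l)) * (1# - X (k ℕ.+ r ℕ.+ w ℕ.* l))))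
          T-product = trans (Σ<-cong D (λ n _ → step n))
            (jacobi (k ℕ.+ r) i (ℕ.≤-trans 0<k (ℕ.m≤m+n k r)) 0<i e+e′)
            where
            step : ∀ n → term 0 i r n ≈ y (k ℕ.+ r) n + y i (suc n)
            step n = trans
              (solve 3 (λ s a b → s :* (s :^ 0 :* (a :- b)) := s :* a :+ (:- s) :* b) refl _ _ _)
              (sym (+-cong (y-closed n) (y-closed′ n)))

module Partitions where

  open import Data.Bool using (Bool; true; false; not; if_then_else_)
  open import Data.List using (List; []; _∷_; _++_; map; concatMap; replicate; filter; length; head; drop)
  open import Data.List.Membership.Propositional using (_∈_)
  open import Data.List.Membership.Propositional.Properties using (∈-++⁺ˡ; ∈-++⁺ʳ; ∈-++⁻; ∈-map⁺; ∈-map⁻; ∈-filter⁺; ∈-filter⁻)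
  open import Data.List.Properties using (++-cancelʳ)
  open import Data.List.Relation.Unary.All as All using (All; []; _∷_)
  import Data.List.Relation.Unary.All.Properties as All
  open import Data.List.Relation.Unary.AllPairs using ([]; _∷_)
  open import Data.List.Relation.Unary.Any using (here; there)
  open import Data.List.Relation.Unary.Unique.Propositional using (Unique)
  import Data.List.Relation.Unary.Unique.Propositional.Properties as Unique
  open import Data.Maybe using (just)
  open import Data.Nat hiding (zero; suc; _≤_; _<_; s≤s; z≤n; ℕ)
  open import Data.Nat.DivMod using (_%_; _/_; m≡m%n+[m/n]*n; [m+kn]%n≡m%n)
  open import Data.Nat.Properties
  open import Data.Sum using (inj₁; inj₂)
  open import Data.Unit using (⊤; tt)
  open import Function.Bundles using (_⇔_; mk⇔; Equivalence)
  open import Relation.Binary.PropositionalEquality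
  open import Relation.Nullary.Decidable using (map′; ¬?; _×-dec_)

  module _ {A : Set} where

    tab : ℕ → (ℕ → List A) → List A
    tab zero    g = []
    tab (suc n) g = tab n g ++ g n

    ∈-tab⁺ : ∀ {n f x} g → f < n → x ∈ g f → x ∈ tab n g
    ∈-tab⁺ {suc n} {f} g f<1+n x∈ with m≤n⇒m<n∨m≡n (≤-pred f<1+n)
    ... | inj₁ f<n  = ∈-++⁺ˡ (∈-tab⁺ g f<n x∈)
    ... | inj₂ refl = ∈-++⁺ʳ (tab n g) x∈

    ∈-tab⁻ : ∀ n {x} g → x ∈ tab n g → ∃[ f ] f < n × x ∈ g f
    ∈-tab⁻ (suc n) g x∈ with ∈-++⁻ (tab n g) x∈
    ... | inj₁ x∈tab with f , f<n , x∈gf ← ∈-tab⁻ n g x∈tab = f , m<n⇒m<1+n f<n , x∈gf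
    ... | inj₂ x∈gn = n , ≤-refl , x∈gn

    tab-unique : ∀ n g (index : A → ℕ) → (∀ f → Unique (g f)) →
                 (∀ f {x} → x ∈ g f → index x ≡ f) → Unique (tab n g)
    tab-unique zero    g index uniq idx = []
    tab-unique (suc n) g index uniq idx = Unique.++⁺ (tab-unique n g index uniq idx) (uniq n) disjoint
      where
      disjoint : ∀ {x} → ¬ (x ∈ tab n g × x ∈ g n)
      disjoint (x∈tab , x∈gn) with f , f<n , x∈gf ← ∈-tab⁻ n g x∈tab =
        <⇒≢ f<n (trans (sym (idx f x∈gf)) (idx n x∈gn))

  Bounded : ℕ → List Part → Set
  Bounded N = All (λ p → val p ≤ N)

  Constant : ℕ → List Part → Set
  Constant v = All (λ p → val p ≡ v)

  -- The block is recovered as the longest prefix of value N+1, since nothing in the rest reaches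
  -- that value. This is what keeps the enumeration free of repetitions.
  ++-decode : ∀ {N b b′ xs xs′} → Constant (suc N) b → Constant (suc N) b′ →
              Bounded N xs → Bounded N xs′ → b ++ xs ≡ b′ ++ xs′ → b ≡ b′ × xs ≡ xs′
  ++-decode []        []        _         _         eq   = refl , eq
  ++-decode []        (v≡ ∷ _)  (v≤ ∷ _)  _         refl = contradiction (≤-trans (≤-reflexive (sym v≡)) v≤) 1+n≰n
  ++-decode (v≡ ∷ _)  []        _         (v≤ ∷ _)  refl = contradiction (≤-trans (≤-reflexive (sym v≡)) v≤) 1+n≰n
  ++-decode (_ ∷ bs)  (_ ∷ bs′) xs≤       xs′≤      eq with refl ← cong head eq
    with ++-decode bs bs′ xs≤ xs′≤ (cong (drop 1) eq)
  ... | refl , refl = refl , refl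

  -- Common to both kinds of partition: all parts of value N+1 are prepended at once. The admissible
  -- blocks may depend on the list below, as the difference condition requires.
  module Levels
    (base : List (List Part))
    (base-unique : Unique base)
    (base-bounded : ∀ {xs} → xs ∈ base → Bounded 0 xs)
    (blocks : ℕ → List Part → List (List Part))
    (blocks-unique : ∀ v xs → Unique (blocks v xs))
    (blocks-constant : ∀ v xs {b} → b ∈ blocks v xs → Constant v b)
    where

    extend : ℕ → List Part → List (List Part)
    extend v xs = map (_++ xs) (blocks v xs)

    levels : ℕ → List (List Part)
    levels zero    = base
    levels (suc N) = concatMap (extend (suc N)) (levels N)

    ∈-extend⁻ : ∀ v xss {y} → y ∈ concatMap (extend v) xss →
                ∃[ xs ] ∃[ b ] xs ∈ xss × b ∈ blocks v xs × y ≡ b ++ xs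
    ∈-extend⁻ v (xs ∷ xss) y∈ with ∈-++⁻ (extend v xs) y∈
    ... | inj₁ y∈xs with b , b∈ , eq ← ∈-map⁻ (_++ xs) y∈xs = xs , b , here refl , b∈ , eq
    ... | inj₂ y∈xss with xs′ , b , xs′∈ , b∈ , eq ← ∈-extend⁻ v xss y∈xss = xs′ , b , there xs′∈ , b∈ , eq

    ∈-extend⁺ : ∀ v {xss xs b} → xs ∈ xss → b ∈ blocks v xs → b ++ xs ∈ concatMap (extend v) xss
    ∈-extend⁺ v {xss = xs ∷ _}  (here refl) b∈ = ∈-++⁺ˡ (∈-map⁺ (_++ xs) b∈)
    ∈-extend⁺ v {xss = xs ∷ _} (there xs∈) b∈ = ∈-++⁺ʳ (extend v xs) (∈-extend⁺ v xs∈ b∈)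

    levels-bounded : ∀ N {xs} → xs ∈ levels N → Bounded N xs
    levels-bounded zero    xs∈ = base-bounded xs∈
    levels-bounded (suc N) y∈ with xs , b , xs∈ , b∈ , refl ← ∈-extend⁻ (suc N) (levels N) y∈ =
      All.++⁺ (All.map ≤-reflexive (blocks-constant (suc N) xs b∈))
              (All.map m≤n⇒m≤1+n (levels-bounded N xs∈))

    levels-unique : ∀ N → Unique (levels N)
    levels-unique zero    = base-unique
    levels-unique (suc N) = go (levels N) (levels-unique N) (levels-bounded N)
      where
      go : ∀ xss → Unique xss → (∀ {xs} → xs ∈ xss → Bounded N xs) → Unique (concatMap (extend (suc N)) xss)
      go []         _          _   = []
      go (xs ∷ xss) (xs∉ ∷ uq) bnd = Unique.++⁺
        (Unique.map⁺ (λ {b} {b′} → ++-cancelʳ xs b b′) (blocks-unique (suc N) xs))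
        (go xss uq (bnd ∘ there))
        disjoint
        where
        disjoint : ∀ {y} → ¬ (y ∈ extend (suc N) xs × y ∈ concatMap (extend (suc N)) xss)
        disjoint (y∈ , y∈′) with b , b∈ , refl ← ∈-map⁻ (_++ xs) y∈
          with xs′ , b′ , xs′∈ , b′∈ , eq ← ∈-extend⁻ (suc N) xss y∈′
          with _ , refl ← ++-decode (blocks-constant _ _ b∈) (blocks-constant _ _ b′∈)
                            (bnd (here refl)) (bnd (there xs′∈)) eq
          = All.lookup xs∉ xs′∈ refl

  total-++ : ∀ xs ys → total (xs ++ ys) ≡ total xs + total ys
  total-++ []       ys = refl
  total-++ (x ∷ xs) ys = trans (cong (val x +_) (total-++ xs ys)) (sym (+-assoc (val x) _ _))

  total-replicate : ∀ f p → total (replicate f p) ≡ f * val p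
  total-replicate zero    p = refl
  total-replicate (suc f) p = cong (val p +_) (total-replicate f p)

  total-bounded : ∀ xs → Bounded (total xs) xs
  total-bounded []       = []
  total-bounded (x ∷ xs) = m≤m+n (val x) _ ∷ All.map (λ p → ≤-trans p (m≤n+m _ (val x))) (total-bounded xs)

  plain : List Part → ℕ
  plain = countP (not ∘ ovl)

  rep : ℕ → ℕ → List Part
  rep v f = replicate f (v , false)

  plain-rep : ∀ v f → plain (rep v f) ≡ f
  plain-rep v zero    = refl
  plain-rep v (suc f) = cong suc (plain-rep v f)

  rep-constant : ∀ v f → Constant v (rep v f)
  rep-constant v f = All.replicate⁺ f refl

  hasCount : ∀ {P : List Part → Set} L n → Unique L → (∀ x → (x ∈ L × total x ≡ n) ⇔ P x) →
             HasCount P (length (filter (λ x → total x ≟ n) L))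
  hasCount L n uniq L⇔P = filter total≟ L , Unique.filter⁺ total≟ uniq ,
    (λ x → mk⇔ (λ x∈ → Equivalence.to (L⇔P x) (∈-filter⁻ total≟ x∈))
               (λ px → let x∈ , eq = Equivalence.from (L⇔P x) px in ∈-filter⁺ total≟ x∈ eq)) ,
    refl
    where
    total≟ = λ x → total x ≟ n

  superBlock : ℕ → ℕ → Bool → List Part
  superBlock v f false = rep v f
  superBlock v f true  = (v , true) ∷ rep v f

  Precedes : Part → List Part → Set
  Precedes p []      = ⊤
  Precedes p (q ∷ _) = val q ≤ val p × (ovl q ≡ true → val q < val p)

  -- The least value that the part k-1 places further on must not reach. Lists being non-increasing,
  -- the difference condition at a part says that at most k-2 later parts reach its threshold.
  threshold : Part → ℕ
  threshold (v , true)  = v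
  threshold (v , false) = pred v

  -- Superpartitions with the difference condition

  module Super (k i : ℕ) (3≤k : 3 ≤ k) (2≤i : 2 ≤ i) (i≤k∸1 : i ≤ k ∸ 1) where

    k∸i≤k∸2 : k ∸ i ≤ k ∸ 2
    k∸i≤k∸2 = ∸-monoʳ-≤ k 2≤i

    2+[k∸2] : 2 + (k ∸ 2) ≡ k
    2+[k∸2] = m+[n∸m]≡n (≤-trans (n≤1+n 2) 3≤k)

    i≤k : i ≤ k
    i≤k = ≤-trans i≤k∸1 (m∸n≤m k 1)

    virtual : ℕ → ℕ
    virtual zero    = k ∸ i
    virtual (suc _) = 0

    atLeast : ℕ → Part → ℕ
    atLeast v p with v ≤? val p
    ... | yes _ = 1
    ... | no  _ = 0

    -- The parts of value at least v, counting k ∸ i further virtual parts 0: these turn the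
    -- bound on the multiplicities of 1 and 0̄ into an instance of the difference condition.
    count≥ : ℕ → List Part → ℕ
    count≥ v []       = virtual v
    count≥ v (p ∷ ps) = atLeast v p + count≥ v ps

    atLeast-yes : ∀ {v p} → v ≤ val p → atLeast v p ≡ 1
    atLeast-yes {v} {p} v≤p with v ≤? val p
    ... | yes _  = refl
    ... | no v≰p = contradiction v≤p v≰p

    atLeast-no : ∀ {v p} → val p < v → atLeast v p ≡ 0
    atLeast-no {v} {p} p<v with v ≤? val p
    ... | yes v≤p = contradiction p<v (≤⇒≯ v≤p)
    ... | no _    = refl

    atLeast-antitone : ∀ {u v} p → u ≤ v → atLeast v p ≤ atLeast u p
    atLeast-antitone {u} {v} p u≤v with v ≤? val p
    ... | yes v≤p = ≤-reflexive (sym (atLeast-yes {u} {p} (≤-trans u≤v v≤p)))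
    ... | no _    = z≤n

    atLeast≤1 : ∀ v p → atLeast v p ≤ 1
    atLeast≤1 v p with v ≤? val p
    ... | yes _ = ≤-refl
    ... | no _  = z≤n

    virtual-antitone : ∀ {u v} → u ≤ v → virtual v ≤ virtual u
    virtual-antitone {zero}  {zero}  _ = ≤-refl
    virtual-antitone {zero}  {suc v} _ = z≤n
    virtual-antitone {suc u} {suc v} _ = z≤n

    count≥-antitone : ∀ {u v} ps → u ≤ v → count≥ v ps ≤ count≥ u ps
    count≥-antitone []       u≤v = virtual-antitone u≤v
    count≥-antitone (p ∷ ps) u≤v = +-mono-≤ (atLeast-antitone p u≤v) (count≥-antitone ps u≤v)

    virtual≤ : ∀ v → virtual v ≤ k ∸ 2
    virtual≤ zero    = k∸i≤k∸2
    virtual≤ (suc _) = z≤n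

    count≥-rep : ∀ {u v} f xs → u ≤ v → count≥ u (rep v f ++ xs) ≡ f + count≥ u xs
    count≥-rep zero    xs u≤v = refl
    count≥-rep {u} {v} (suc f) xs u≤v = cong₂ _+_ (atLeast-yes {u} {v , false} u≤v) (count≥-rep f xs u≤v)

    count≥-above : ∀ {N} xs → Bounded N xs → count≥ (suc N) xs ≡ 0
    count≥-above []       []       = refl
    count≥-above {N} (p ∷ xs) (p≤ ∷ b) = cong₂ _+_ (atLeast-no {suc N} {p} (s≤s p≤)) (count≥-above xs b)

    count≥-superBlock : ∀ {N} f g xs → Bounded N xs →
                        count≥ (suc N) (superBlock (suc N) f g ++ xs) ≡ (if g then suc f else f)
    count≥-superBlock {N} f false xs b = trans (count≥-rep f xs ≤-refl)
      (trans (cong (f +_) (count≥-above xs b)) (+-identityʳ f))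
    count≥-superBlock {N} f true  xs b = cong₂ _+_ (atLeast-yes {suc N} {suc N , true} ≤-refl)
      (count≥-superBlock f false xs b)

    -- Every requirement on a part is stated through the list after it, so that lists can be grown
    -- at the front. Threshold 0 occurs only for a plain 1 and for the overlined 0, and there the
    -- virtual parts enter the count.
    Sup : List Part → Set
    Sup []       = ⊤
    Sup (p ∷ ps) = Precedes p ps × (ovl p ≡ false → 0 < val p)
                   × count≥ (threshold p) ps ≤ k ∸ 2 × Sup ps

    Sup-bounded : ∀ {N p} ps → Sup (p ∷ ps) → val p ≤ N → Bounded N (p ∷ ps)
    Sup-bounded []       _                            p≤N = p≤N ∷ []
    Sup-bounded (q ∷ ps) ((q≤p , _) , _ , _ , sup) p≤N = p≤N ∷ Sup-bounded ps sup (≤-trans q≤p p≤N)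

    threshold≤ : ∀ p → threshold p ≤ val p
    threshold≤ (v , true)  = ≤-refl
    threshold≤ (v , false) = pred[n]≤n

    -- The head adds at most 1 to the k-2 allowed after it. Hence the index k-c of the weight is
    -- always positive.
    count≥<k : ∀ {N} xs → Sup xs → Bounded N xs → count≥ N xs < k
    count≥<k {N} [] _ _ = ≤-trans (s≤s (virtual≤ N)) (≤-trans (n≤1+n _) (≤-reflexive 2+[k∸2]))
    count≥<k {N} (p ∷ ps) (_ , _ , c≤ , _) (p≤N ∷ _) = ≤-trans
      (s≤s (+-mono-≤ (atLeast≤1 N p) (≤-trans (count≥-antitone ps (≤-trans (threshold≤ p) p≤N)) c≤)))
      (≤-reflexive 2+[k∸2])

    -- An overlined v has threshold v and meets only the `f` plain copies behind it, so it is
    -- allowed exactly for f ≤ k-2.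
    blocks′ : ℕ → ℕ → List (List Part)
    blocks′ v f with suc f <? k
    ... | yes _ = superBlock v f false ∷ superBlock v f true ∷ []
    ... | no  _ = superBlock v f false ∷ []

    ∈-blocks′⁻ : ∀ v f {b} → b ∈ blocks′ v f → ∃[ g ] b ≡ superBlock v f g × (g ≡ true → suc f < k)
    ∈-blocks′⁻ v f b∈ with suc f <? k
    ∈-blocks′⁻ v f (here refl)         | yes _ = false , refl , λ ()
    ∈-blocks′⁻ v f (there (here refl)) | yes p = true , refl , λ _ → p
    ∈-blocks′⁻ v f (here refl)         | no _  = false , refl , λ ()

    ∈-blocks′⁺ : ∀ v f g → (g ≡ true → suc f < k) → superBlock v f g ∈ blocks′ v f
    ∈-blocks′⁺ v f g cond with suc f <? k
    ∈-blocks′⁺ v f false cond | yes _ = here refl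
    ∈-blocks′⁺ v f true  cond | yes _ = there (here refl)
    ∈-blocks′⁺ v f false cond | no _  = here refl
    ∈-blocks′⁺ v f true  cond | no ¬p = contradiction (cond refl) ¬p

    -- A plain v has threshold v-1, so the first of `f` copies sees f-1 others and the c parts of
    -- value v-1 below. The requirement f-1+c ≤ k-2 is f < k-c.
    superBlocks : ℕ → List Part → List (List Part)
    superBlocks v xs = tab (k ∸ count≥ (pred v) xs) (blocks′ v)

    superBlocks-unique : ∀ v xs → Unique (superBlocks v xs)
    superBlocks-unique v xs = tab-unique (k ∸ count≥ (pred v) xs) (blocks′ v) plain uniq index
      where
      uniq : ∀ f → Unique (blocks′ v f)
      uniq f with suc f <? k
      ... | yes _ = ((λ eq → head≢ f eq) ∷ []) ∷ [] ∷ []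
        where
        head≢ : ∀ f → superBlock v f false ≢ superBlock v f true
        head≢ zero    ()
        head≢ (suc f) ()
      ... | no _  = [] ∷ []
      index : ∀ f {b} → b ∈ blocks′ v f → plain b ≡ f
      index f b∈ with ∈-blocks′⁻ v f b∈
      ... | false , refl , _ = plain-rep v f
      ... | true  , refl , _ = plain-rep v f

    superBlocks-constant : ∀ v xs {b} → b ∈ superBlocks v xs → Constant v b
    superBlocks-constant v xs b∈ with f , _ , b∈′ ← ∈-tab⁻ (k ∸ count≥ (pred v) xs) (blocks′ v) b∈ with ∈-blocks′⁻ v f b∈′
    ... | false , refl , _ = rep-constant v f
    ... | true  , refl , _ = refl ∷ rep-constant v f

    superBase : List (List Part)
    superBase = [] ∷ ((0 , true) ∷ []) ∷ []

    superBase-bounded : ∀ {xs} → xs ∈ superBase → Bounded 0 xs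
    superBase-bounded (here refl)         = []
    superBase-bounded (there (here refl)) = z≤n ∷ []

    superBase-unique : Unique superBase
    superBase-unique = ((λ ()) ∷ []) ∷ [] ∷ []

    open Levels superBase superBase-unique superBase-bounded
      superBlocks superBlocks-unique superBlocks-constant public

    Precedes-bounded : ∀ {N} o xs → Bounded N xs → Precedes (suc N , o) xs
    Precedes-bounded o []       _        = tt
    Precedes-bounded o (q ∷ xs) (q≤ ∷ _) = m≤n⇒m≤1+n q≤ , λ _ → s≤s q≤

    Precedes-rep : ∀ {N} o f xs → Bounded N xs → Precedes (suc N , o) (rep (suc N) f ++ xs)
    Precedes-rep o zero    xs b = Precedes-bounded o xs b
    Precedes-rep o (suc f) xs b = ≤-refl , λ ()

    to<k : ∀ {m} → m ≤ k ∸ 2 → suc m < k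
    to<k m≤ = ≤-trans (s≤s (s≤s m≤)) (≤-reflexive 2+[k∸2])

    from<k : ∀ {m} → suc m < k → m ≤ k ∸ 2
    from<k = ∸-monoˡ-≤ 2

    Sup-rep : ∀ {N} f xs → Sup xs → Bounded N xs → f + count≥ N xs < k → Sup (rep (suc N) f ++ xs)
    Sup-rep zero    xs sup b _ = sup
    Sup-rep {N} (suc f) xs sup b lt = Precedes-rep false f xs b , (λ _ → s≤s z≤n) ,
      ≤-trans (≤-reflexive (count≥-rep f xs (n≤1+n N))) (from<k lt) ,
      Sup-rep f xs sup b (<-trans (n<1+n _) lt)

    Sup-superBlock : ∀ {N} f g xs → Sup xs → Bounded N xs → f + count≥ N xs < k → (g ≡ true → suc f < k) →
                     Sup (superBlock (suc N) f g ++ xs)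
    Sup-superBlock f false xs sup b lt _ = Sup-rep f xs sup b lt
    Sup-superBlock {N} f true xs sup b lt 1+f<k = Precedes-rep true f xs b , (λ ()) ,
      ≤-trans (≤-reflexive (count≥-superBlock f false xs b)) (from<k (1+f<k refl)) ,
      Sup-rep f xs sup b lt

    <∸⇒+< : ∀ {f c} → f < k ∸ c → f + c < k
    <∸⇒+< {f} {c} p = ≤-trans (+-monoˡ-≤ c p) (≤-reflexive (m∸n+n≡m (<⇒≤ (m∸n≢0⇒n<m {k} {c} (m<n⇒n≢0 p)))))

    +<⇒<∸ : ∀ {f c} → f + c < k → f < k ∸ c
    +<⇒<∸ {f} {c} p = ≤-trans (≤-reflexive (sym (m+n∸n≡m (suc f) c))) (∸-monoˡ-≤ c p)

    levels-sound : ∀ N {xs} → xs ∈ levels N → Sup xs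
    levels-sound zero    (here refl)         = tt
    levels-sound zero    (there (here refl)) = tt , (λ ()) , k∸i≤k∸2 , tt
    levels-sound (suc N) y∈ with xs , b , xs∈ , b∈ , refl ← ∈-extend⁻ (suc N) (levels N) y∈
      with f , f< , b∈′ ← ∈-tab⁻ (k ∸ count≥ N xs) (blocks′ (suc N)) b∈
      with g , refl , cond ← ∈-blocks′⁻ (suc N) f b∈′
      = Sup-superBlock f g xs (levels-sound N xs∈) (levels-bounded N xs∈) (<∸⇒+< f<) cond

    record Split (N : ℕ) (y : List Part) : Set where
      constructor split
      field
        f     : ℕ
        g     : Bool
        xs    : List Part
        y≡    : y ≡ superBlock (suc N) f g ++ xs
        sup   : Sup xs
        bnd   : Bounded N xs
        f+<k  : f + count≥ N xs < k
        1+f<k : g ≡ true → suc f < k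

    split-Sup : ∀ N y → Sup y → Bounded (suc N) y → Split N y
    split-Sup N [] sup b = split 0 false [] refl tt [] (count≥<k {N} [] tt []) λ ()
    split-Sup N (p ∷ y) sup (p≤ ∷ b) with m≤n⇒m<n∨m≡n p≤
    ... | inj₁ p<  = split 0 false (p ∷ y) refl sup bnd (count≥<k (p ∷ y) sup bnd) λ ()
      where
      bnd : Bounded N (p ∷ y)
      bnd = Sup-bounded y sup (≤-pred p<)
    split-Sup N ((_ , o) ∷ y) (prec , _ , c≤ , supy) (p≤ ∷ b) | inj₂ refl with split-Sup N y supy b
    -- The tail already starts with the overlined N+1, and the first-occurrence rule forbids another
    -- N+1 before it.
    ... | split f true xs refl sup bnd f+<k 1+f<k = contradiction (proj₂ prec refl) (<-irrefl refl)
    split-Sup N ((_ , false) ∷ y) (prec , _ , c≤ , supy) (p≤ ∷ b) | inj₂ refl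
        | split f false xs refl sup bnd f+<k 1+f<k =
      split (suc f) false xs refl sup bnd
        (to<k (≤-trans (≤-reflexive (sym (count≥-rep f xs (n≤1+n N)))) c≤)) λ ()
    split-Sup N ((_ , true) ∷ y) (prec , _ , c≤ , supy) (p≤ ∷ b) | inj₂ refl
        | split f false xs refl sup bnd f+<k 1+f<k =
      split f true xs refl sup bnd f+<k
        (λ _ → to<k (≤-trans (≤-reflexive (sym (count≥-superBlock f false xs bnd))) c≤))

    levels-complete : ∀ N {y} → Sup y → Bounded N y → y ∈ levels N
    levels-complete zero {[]} _ _ = here refl
    levels-complete zero {(_ , false) ∷ _} (_ , pos , _) (z≤n ∷ _) = contradiction (pos refl) λ ()
    levels-complete zero {(_ , true) ∷ []} _ (z≤n ∷ _) = there (here refl)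
    levels-complete zero {(_ , true) ∷ (_ , true) ∷ _} ((_ , lt) , _) (z≤n ∷ _) = contradiction (lt refl) λ ()
    levels-complete zero {(_ , true) ∷ (_ , false) ∷ _} (_ , _ , _ , _ , pos , _) (z≤n ∷ z≤n ∷ _) = contradiction (pos refl) λ ()
    levels-complete (suc N) {y} supy b with split f g xs refl sup bnd f+<k cond ← split-Sup N y supy b =
      ∈-extend⁺ (suc N) (levels-complete N sup bnd)
        (∈-tab⁺ (blocks′ (suc N)) (+<⇒<∸ f+<k) (∈-blocks′⁺ (suc N) f g cond))

    atLeast-sum : ℕ → List Part → ℕ
    atLeast-sum v []       = 0
    atLeast-sum v (p ∷ ps) = atLeast v p + atLeast-sum v ps

    count≥-virtual : ∀ v ps → count≥ v ps ≡ atLeast-sum v ps + virtual v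
    count≥-virtual v []       = refl
    count≥-virtual v (p ∷ ps) = trans (cong (atLeast v p +_) (count≥-virtual v ps))
      (sym (+-assoc (atLeast v p) _ _))

    NonIncr-tail : ∀ {p} ps → NonIncr (p ∷ ps) → NonIncr ps
    NonIncr-tail []      _ = tt
    NonIncr-tail (_ ∷ _)   = proj₂

    NonIncr-bounded : ∀ {p} ps → NonIncr (p ∷ ps) → Bounded (val p) ps
    NonIncr-bounded []       _           = []
    NonIncr-bounded (q ∷ ps) (q≤p , ni) = q≤p ∷ All.map (λ r → ≤-trans r q≤p) (NonIncr-bounded ps ni)

    nth-bounded : ∀ {N} j {ps q} → Bounded N ps → head (drop j ps) ≡ just q → val q ≤ N
    nth-bounded zero    (p≤ ∷ _) refl = p≤
    nth-bounded (suc j) (_ ∷ b)  eq   = nth-bounded j b eq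

    -- The parts of value at least `v` form a prefix of a non-increasing list, so position `j`
    -- reaches `v` exactly when more than `j` parts do. `<⇒nth` is the other direction.
    nth⇒< : ∀ j v ps {q} → NonIncr ps → head (drop j ps) ≡ just q → v ≤ val q → j < atLeast-sum v ps
    nth⇒< zero    v (p ∷ ps) ni refl v≤ = ≤-trans (≤-reflexive (sym (atLeast-yes {v} {p} v≤))) (m≤m+n _ _)
    nth⇒< (suc j) v (p ∷ ps) ni eq   v≤ = ≤-trans
      (s≤s (nth⇒< j v ps (NonIncr-tail ps ni) eq v≤))
      (≤-reflexive (cong (_+ atLeast-sum v ps) (sym (atLeast-yes {v} {p}
        (≤-trans v≤ (nth-bounded j (NonIncr-bounded ps ni) eq))))))

    atLeast-sum-above : ∀ {v} ps → All (λ p → val p < v) ps → atLeast-sum v ps ≡ 0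
    atLeast-sum-above []       []       = refl
    atLeast-sum-above {v} (p ∷ ps) (p< ∷ b) = cong₂ _+_ (atLeast-no {v} {p} p<) (atLeast-sum-above ps b)

    <⇒nth : ∀ j v ps → NonIncr ps → j < atLeast-sum v ps → ∃[ q ] head (drop j ps) ≡ just q × v ≤ val q
    <⇒nth j v (p ∷ ps) ni j< with v ≤? val p
    <⇒nth zero    v (p ∷ ps) ni j<       | yes v≤p = p , refl , v≤p
    <⇒nth (suc j) v (p ∷ ps) ni (s≤s j<) | yes v≤p = <⇒nth j v ps (NonIncr-tail ps ni) j<
    <⇒nth j v (p ∷ ps) ni j< | no v≰p = contradiction
      (subst (j <_) (atLeast-sum-above ps (All.map (λ r → ≤-<-trans r (≰⇒> v≰p)) (NonIncr-bounded ps ni))) j<) λ ()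

    gap-threshold⁺ : ∀ p {x} → x + gap p ≤ val p → x < threshold p
    gap-threshold⁺ (v     , true)  {x} le = ≤-trans (≤-reflexive (+-comm 1 x)) le
    gap-threshold⁺ (zero  , false) {x} le = contradiction (≤-trans (≤-reflexive (+-comm 2 x)) le) λ ()
    gap-threshold⁺ (suc v , false) {x} le = ≤-pred (≤-trans (≤-reflexive (+-comm 2 x)) le)

    gap-threshold⁻ : ∀ p {x} → x < threshold p → x + gap p ≤ val p
    gap-threshold⁻ (v     , true)  {x} lt = ≤-trans (≤-reflexive (+-comm x 1)) lt
    gap-threshold⁻ (suc v , false) {x} lt = ≤-trans (≤-reflexive (+-comm x 2)) (s≤s lt)

    DiffCond⇒ : ∀ p ps → NonIncr ps → (∀ q → head (drop (k ∸ 2) ps) ≡ just q → val q + gap p ≤ val p) →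
                atLeast-sum (threshold p) ps ≤ k ∸ 2
    DiffCond⇒ p ps ni cond = ≮⇒≥ λ lt → let q , eq , v≤ = <⇒nth (k ∸ 2) (threshold p) ps ni lt in
      <⇒≱ (gap-threshold⁺ p (cond q eq)) v≤

    ⇒DiffCond : ∀ p ps → NonIncr ps → atLeast-sum (threshold p) ps ≤ k ∸ 2 →
                ∀ q → head (drop (k ∸ 2) ps) ≡ just q → val q + gap p ≤ val p
    ⇒DiffCond p ps ni le q eq = gap-threshold⁻ p (≰⇒> λ v≤ → <⇒≱ (nth⇒< (k ∸ 2) (threshold p) ps ni eq v≤) le)

    uncons : ∀ p ps → NonIncr (p ∷ ps) → FirstOcc (p ∷ ps) → Precedes p ps × FirstOcc ps
    uncons p []       _         _         = tt , tt
    uncons p (q ∷ ps) (q≤p , _) (lt , fo) = (q≤p , lt) , fo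

    small : List Part → ℕ
    small ps = countP isNonOvlOne ps + countP isOvlZero ps

    small-∷ : ∀ p ps → small (p ∷ ps) ≡ small (p ∷ []) + small ps
    small-∷ p ps = eq (if isNonOvlOne p then 1 else 0) (if isOvlZero p then 1 else 0)
      (countP isNonOvlOne ps) (countP isOvlZero ps)
      where
      eq : ∀ a b c d → a + c + (b + d) ≡ a + 0 + (b + 0) + (c + d)
      eq = solve-∀

    small≤1 : ∀ p → small (p ∷ []) ≤ 1
    small≤1 (zero        , true)  = ≤-refl
    small≤1 (zero        , false) = z≤n
    small≤1 (suc zero    , true)  = z≤n
    small≤1 (suc zero    , false) = ≤-refl
    small≤1 (suc (suc _) , _)     = z≤n

    small≤ : ∀ ps → small ps ≤ atLeast-sum 0 ps
    small≤ []       = z≤n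
    small≤ (p ∷ ps) = ≤-trans (≤-reflexive (small-∷ p ps)) (+-mono-≤
      (≤-trans (small≤1 p) (≤-reflexive (sym (atLeast-yes {0} {p} z≤n)))) (small≤ ps))

    -- After a plain 1 no overlined 1 can occur, so all that follows is plain ones and possibly the
    -- overlined 0, and `small` misses nothing.
    ≤small : ∀ ps → Precedes (1 , false) ps → NonIncr ps → FirstOcc ps → NonOvlPos ps →
             atLeast-sum 0 ps ≤ small ps
    ≤small [] _ _ _ _ = z≤n
    ≤small (p ∷ ps) prec ni fo (pos , nop) with uncons p ps ni fo
    ≤small ((zero , false) ∷ ps) prec ni fo (pos , nop) | _ = contradiction (pos refl) λ ()
    ≤small ((zero , true) ∷ []) prec ni fo (pos , nop) | _ = ≤-refl
    ≤small ((zero , true) ∷ (_ , true) ∷ _) prec ni (lt , fo) (pos , nop) | _ = contradiction (lt refl) λ ()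
    ≤small ((zero , true) ∷ (_ , false) ∷ _) prec (z≤n , ni) fo (_ , pos , nop) | _ = contradiction (pos refl) λ ()
    ≤small ((suc zero , true) ∷ ps) (_ , lt) ni fo nop | _ = contradiction (lt refl) (<-irrefl refl)
    ≤small ((suc zero , false) ∷ ps) prec ni fo (pos , nop) | prec′ , fo′ =
      s≤s (≤small ps prec′ (NonIncr-tail ps ni) fo′ nop)
    ≤small ((suc (suc _) , _) ∷ ps) (s≤s () , _) ni fo nop | _

    -- The origin of the constant k-i: with `c` small parts behind a first one, the bound 1 + c ≤
    -- i-1 is c + (k-i) ≤ k-2.
    virtual-bound⁺ : ∀ {c} → suc c ≤ i ∸ 1 → c + (k ∸ i) ≤ k ∸ 2
    virtual-bound⁺ {c} le = ≤-trans (+-monoˡ-≤ (k ∸ i) c≤) (≤-reflexive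
      (trans (+-comm (i ∸ 2) (k ∸ i)) (trans (sym (+-∸-assoc (k ∸ i) 2≤i)) (cong (_∸ 2) (m∸n+n≡m i≤k)))))
      where
      c≤ : c ≤ i ∸ 2
      c≤ = ≤-trans (∸-monoˡ-≤ 1 le) (≤-reflexive (∸-+-assoc i 1 1))

    virtual-bound⁻ : ∀ {c} → c + (k ∸ i) ≤ k ∸ 2 → suc c ≤ i ∸ 1
    virtual-bound⁻ {c} le = ∸-monoˡ-≤ 1 (+-cancelʳ-≤ (k ∸ i) (2 + c) i
      (≤-trans (s≤s (s≤s le)) (≤-reflexive (trans 2+[k∸2] (sym (m+[n∸m]≡n i≤k))))))

    Good⇒Sup : ∀ ps → NonIncr ps → FirstOcc ps → NonOvlPos ps → DiffCond k ps → small ps ≤ i ∸ 1 → Sup ps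
    Good⇒Sup [] _ _ _ _ _ = tt
    Good⇒Sup (p ∷ ps) ni fo (pos , nop) (dc , dcs) sm =
      proj₁ (uncons p ps ni fo) , pos , bound p pos dc ni fo sm ,
      Good⇒Sup ps (NonIncr-tail ps ni) (proj₂ (uncons p ps ni fo)) nop dcs
        (≤-trans (≤-trans (m≤n+m _ (small (p ∷ []))) (≤-reflexive (sym (small-∷ p ps)))) sm)
      where
      nonvirtual : ∀ p v → threshold p ≡ suc v → NonIncr (p ∷ ps) →
        (∀ q → head (drop (k ∸ 2) ps) ≡ just q → val q + gap p ≤ val p) → count≥ (threshold p) ps ≤ k ∸ 2
      nonvirtual p v eq ni dc = ≤-trans (≤-reflexive (trans (count≥-virtual (threshold p) ps)
        (trans (cong (λ t → atLeast-sum (threshold p) ps + virtual t) eq) (+-identityʳ _))))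
        (DiffCond⇒ p ps (NonIncr-tail ps ni) dc)
      zero-tail : ∀ ps → NonIncr ((0 , true) ∷ ps) → FirstOcc ((0 , true) ∷ ps) → NonOvlPos ps →
                  count≥ 0 ps ≤ k ∸ 2
      zero-tail []               _         _        _         = k∸i≤k∸2
      zero-tail ((_ , true) ∷ _) _         (lt , _) _         = contradiction (lt refl) λ ()
      zero-tail ((_ , false) ∷ _) (z≤n , _) _        (pos , _) = contradiction (pos refl) λ ()
      bound : ∀ p → (ovl p ≡ false → 0 < val p) →
        (∀ q → head (drop (k ∸ 2) ps) ≡ just q → val q + gap p ≤ val p) →
        NonIncr (p ∷ ps) → FirstOcc (p ∷ ps) → small (p ∷ ps) ≤ i ∸ 1 → count≥ (threshold p) ps ≤ k ∸ 2
      bound (zero , false) pos dc ni fo sm = contradiction (pos refl) λ ()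
      -- Nothing can follow the overlined 0, so the count is just k-i, which is at most k-2 because
      -- i ≥ 2.
      bound (zero , true)  pos dc ni fo sm = zero-tail ps ni fo nop
      bound (suc v , true) pos dc ni fo sm = nonvirtual (suc v , true) v refl ni dc
      -- Here the bound comes from the hypothesis on ones and the overlined 0, and not from the
      -- difference condition.
      bound (suc zero , false) pos dc ni fo sm = ≤-trans (≤-reflexive (count≥-virtual 0 ps))
        (virtual-bound⁺ (≤-trans (s≤s (≤small ps (proj₁ (uncons _ ps ni fo)) (NonIncr-tail ps ni)
          (proj₂ (uncons _ ps ni fo)) nop)) sm))
      bound (suc (suc v) , false) pos dc ni fo sm = nonvirtual (suc (suc v) , false) v refl ni dc

    Sup⇒NonIncr : ∀ ps → Sup ps → NonIncr ps
    Sup⇒NonIncr []           _                        = tt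
    Sup⇒NonIncr (p ∷ [])     _                        = tt
    Sup⇒NonIncr (p ∷ q ∷ ps) ((q≤p , _) , _ , _ , sup) = q≤p , Sup⇒NonIncr (q ∷ ps) sup

    Sup⇒FirstOcc : ∀ ps → Sup ps → FirstOcc ps
    Sup⇒FirstOcc []           _                        = tt
    Sup⇒FirstOcc (p ∷ [])     _                        = tt
    Sup⇒FirstOcc (p ∷ q ∷ ps) ((_ , lt) , _ , _ , sup) = lt , Sup⇒FirstOcc (q ∷ ps) sup

    Sup⇒NonOvlPos : ∀ ps → Sup ps → NonOvlPos ps
    Sup⇒NonOvlPos []       _                  = tt
    Sup⇒NonOvlPos (p ∷ ps) (_ , pos , _ , sup) = pos , Sup⇒NonOvlPos ps sup

    Sup⇒DiffCond : ∀ ps → Sup ps → DiffCond k ps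
    Sup⇒DiffCond []       _                 = tt
    Sup⇒DiffCond (p ∷ ps) (_ , _ , c≤ , sup) =
      ⇒DiffCond p ps (Sup⇒NonIncr ps sup) (≤-trans (m≤m+n _ (virtual (threshold p)))
        (≤-trans (≤-reflexive (sym (count≥-virtual (threshold p) ps))) c≤)) ,
      Sup⇒DiffCond ps sup

    -- Only the first plain 1 or overlined 0 matters: its threshold is 0, so its own bound already
    -- covers every later part together with the virtual ones.
    Sup⇒small : ∀ ps → Sup ps → small ps ≤ i ∸ 1
    Sup⇒small []       _                    = z≤n
    Sup⇒small (p ∷ ps) (_ , pos , c≤ , sup) = ≤-trans (≤-reflexive (small-∷ p ps)) (step p pos c≤)
      where
      full : count≥ 0 ps ≤ k ∸ 2 → 1 + small ps ≤ i ∸ 1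
      full c≤ = ≤-trans (s≤s (small≤ ps)) (virtual-bound⁻ (≤-trans (≤-reflexive (sym (count≥-virtual 0 ps))) c≤))
      step : ∀ p → (ovl p ≡ false → 0 < val p) → count≥ (threshold p) ps ≤ k ∸ 2 →
             small (p ∷ []) + small ps ≤ i ∸ 1
      step (zero        , false) pos c≤ = contradiction (pos refl) λ ()
      step (zero        , true)  pos c≤ = full c≤
      step (suc zero    , false) pos c≤ = full c≤
      step (suc zero    , true)  pos c≤ = Sup⇒small ps sup
      step (suc (suc _) , _)     pos c≤ = Sup⇒small ps sup

    super-count : ∀ {N n} → n ≤ N →
      HasCount (GoodSuper k i n) (length (filter (λ x → total x ≟ n) (levels N)))
    super-count {N} {n} n≤N = hasCount (levels N) n (levels-unique N) λ ps → mk⇔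
      (λ (ps∈ , eq) → let sup = levels-sound N ps∈ in
        (Sup⇒NonIncr ps sup , Sup⇒FirstOcc ps sup , Sup⇒NonOvlPos ps sup , eq) ,
        Sup⇒DiffCond ps sup , Sup⇒small ps sup)
      (λ ((ni , fo , nop , eq) , dc , sm) →
        levels-complete N (Good⇒Sup ps ni fo nop dc sm)
          (All.map (λ r → ≤-trans r (≤-trans (≤-reflexive eq) n≤N)) (total-bounded ps)) , eq)

  -- Residues and overpartitions

  module _ (m : ℕ) .{{_ : NonZero m}} where

    CongMod⇒% : ∀ {a b} → CongMod m a b → a % m ≡ b % m
    CongMod⇒% {a} {b} (x , y , eq) = trans (sym ([m+kn]%n≡m%n a x m)) (trans (cong (_% m) eq) ([m+kn]%n≡m%n b y m))

    %⇒CongMod : ∀ {a b} → a % m ≡ b % m → CongMod m a b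
    -- Each number receives the quotient of the other, so both sides become the common remainder
    -- plus the same multiples of m.
    %⇒CongMod {a} {b} eq = b / m , a / m , (begin
      a + b / m * m                     ≡⟨ cong (_+ b / m * m) (m≡m%n+[m/n]*n a m) ⟩
      a % m + a / m * m + b / m * m     ≡⟨ cong (λ z → z + a / m * m + b / m * m) eq ⟩
      b % m + a / m * m + b / m * m     ≡⟨ +-assoc (b % m) _ _ ⟩
      b % m + (a / m * m + b / m * m)   ≡⟨ cong (b % m +_) (+-comm (a / m * m) _) ⟩
      b % m + (b / m * m + a / m * m)   ≡⟨ +-assoc (b % m) _ _ ⟨
      b % m + b / m * m + a / m * m     ≡⟨ cong (_+ a / m * m) (m≡m%n+[m/n]*n b m) ⟨
      b + a / m * m                     ∎)
      where open ≡-Reasoning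

    congMod? : ∀ a b → Dec (CongMod m a b)
    congMod? a b = map′ %⇒CongMod CongMod⇒% (a % m ≟ b % m)

  Avoids : ℕ → ℕ → ℕ → Set
  Avoids m r v = ¬ CongMod m v 0 × ¬ CongMod m v r × ¬ CongMod m (v + r) 0

  overBlock : ℕ → ℕ → Bool → List Part
  overBlock v f false = rep v f
  overBlock v f true  = rep v f ++ (v , true) ∷ []

  module Over (m r : ℕ) .{{_ : NonZero m}} (F : ℕ) (0<F : 0 < F) where

    avoids? : ∀ v → Dec (Avoids m r v)
    avoids? v = ¬? (congMod? m v 0) ×-dec ¬? (congMod? m v r) ×-dec ¬? (congMod? m (v + r) 0)

    -- An exclusive bound on the number of plain copies. The value 1 leaves only overlined use of a
    -- forbidden residue; the cap `F` makes the enumeration finite and loses no partition of total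
    -- below `F`.
    multiplicity : ℕ → ℕ
    multiplicity v with avoids? v
    ... | yes _ = F
    ... | no  _ = 1

    0<multiplicity : ∀ v → 0 < multiplicity v
    0<multiplicity v with avoids? v
    ... | yes _ = 0<F
    ... | no  _ = ≤-refl

    multiplicity-avoids : ∀ {v f} → Avoids m r v → f < F → f < multiplicity v
    multiplicity-avoids {v} av f<F with avoids? v
    ... | yes _  = f<F
    ... | no ¬av = contradiction av ¬av

    avoids-multiplicity : ∀ {v f} → suc f < multiplicity v → Avoids m r v
    avoids-multiplicity {v} lt with avoids? v
    ... | yes av = av
    avoids-multiplicity {v} (s≤s ()) | no _

    overBlocks′ : ℕ → ℕ → List (List Part)
    overBlocks′ v f = overBlock v f false ∷ overBlock v f true ∷ []

    overBlocks : ℕ → List Part → List (List Part)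
    overBlocks v _ = tab (multiplicity v) (overBlocks′ v)

    ∈-overBlocks′⁻ : ∀ {v f b} → b ∈ overBlocks′ v f → ∃[ g ] b ≡ overBlock v f g
    ∈-overBlocks′⁻ (here refl)         = false , refl
    ∈-overBlocks′⁻ (there (here refl)) = true , refl

    ∈-overBlocks′⁺ : ∀ v f g → overBlock v f g ∈ overBlocks′ v f
    ∈-overBlocks′⁺ v f false = here refl
    ∈-overBlocks′⁺ v f true  = there (here refl)

    overBlock-constant : ∀ v f g → Constant v (overBlock v f g)
    overBlock-constant v f false = rep-constant v f
    overBlock-constant v f true  = All.++⁺ (rep-constant v f) (refl ∷ [])

    overBlocks-constant : ∀ v xs {b} → b ∈ overBlocks v xs → Constant v b
    overBlocks-constant v xs b∈ with f , _ , b∈′ ← ∈-tab⁻ (multiplicity v) (overBlocks′ v) b∈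
      with g , refl ← ∈-overBlocks′⁻ b∈′ = overBlock-constant v f g

    overBlocks-unique : ∀ v xs → Unique (overBlocks v xs)
    overBlocks-unique v xs = tab-unique (multiplicity v) (overBlocks′ v) plain
      (λ f → (differ f ∷ []) ∷ [] ∷ []) index
      where
      differ : ∀ f → overBlock v f false ≢ overBlock v f true
      differ zero    ()
      differ (suc f) eq = differ f (cong (drop 1) eq)
      plain-true : ∀ f → plain (overBlock v f true) ≡ f
      plain-true zero    = refl
      plain-true (suc f) = cong suc (plain-true f)
      index : ∀ f {b} → b ∈ overBlocks′ v f → plain b ≡ f
      index f b∈ with ∈-overBlocks′⁻ b∈
      ... | false , refl = plain-rep v f
      ... | true  , refl = plain-true f

    overBase : List (List Part)
    overBase = [] ∷ []

    overBase-bounded : ∀ {xs} → xs ∈ overBase → Bounded 0 xs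
    overBase-bounded (here refl) = []

    open Levels overBase ([] ∷ []) overBase-bounded overBlocks overBlocks-unique overBlocks-constant public

    Follows : Part → List Part → Set
    Follows p []      = ⊤
    Follows p (q ∷ _) = val q ≤ val p × (ovl p ≡ true → val q < val p)

    Ov : List Part → Set
    Ov []       = ⊤
    Ov (p ∷ ps) = Follows p ps × 0 < val p × (ovl p ≡ false → Avoids m r (val p)) × Ov ps

    Ov-bounded : ∀ {N p} ps → Ov (p ∷ ps) → val p ≤ N → Bounded N (p ∷ ps)
    Ov-bounded []       _                         p≤N = p≤N ∷ []
    Ov-bounded (q ∷ ps) ((q≤p , _) , _ , _ , ov) p≤N = p≤N ∷ Ov-bounded ps ov (≤-trans q≤p p≤N)

    Follows-bounded : ∀ {N} o xs → Bounded N xs → Follows (suc N , o) xs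
    Follows-bounded o []       _        = tt
    Follows-bounded o (q ∷ xs) (q≤ ∷ _) = m≤n⇒m≤1+n q≤ , λ _ → s≤s q≤

    Ov-overBlock : ∀ {N} f g xs → Ov xs → Bounded N xs → f < multiplicity (suc N) →
                   Ov (overBlock (suc N) f g ++ xs)
    Ov-overBlock zero    false xs ov b _ = ov
    Ov-overBlock zero    true  xs ov b _ = Follows-bounded true xs b , s≤s z≤n , (λ ()) , ov
    Ov-overBlock {N} (suc f) false xs ov b lt = follows f , s≤s z≤n , (λ _ → avoids-multiplicity lt) ,
      Ov-overBlock f false xs ov b (<-trans (n<1+n f) lt)
      where
      follows : ∀ f → Follows (suc N , false) (rep (suc N) f ++ xs)
      follows zero    = Follows-bounded false xs b
      follows (suc f) = ≤-refl , λ ()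
    Ov-overBlock {N} (suc f) true xs ov b lt = follows f , s≤s z≤n , (λ _ → avoids-multiplicity lt) ,
      Ov-overBlock f true xs ov b (<-trans (n<1+n f) lt)
      where
      follows : ∀ f → Follows (suc N , false) ((rep (suc N) f ++ (suc N , true) ∷ []) ++ xs)
      follows zero    = ≤-refl , λ ()
      follows (suc f) = ≤-refl , λ ()

    levels-sound : ∀ N {xs} → xs ∈ levels N → Ov xs
    levels-sound zero    (here refl) = tt
    levels-sound (suc N) y∈ with xs , b , xs∈ , b∈ , refl ← ∈-extend⁻ (suc N) (levels N) y∈
      with f , f< , b∈′ ← ∈-tab⁻ (multiplicity (suc N)) (overBlocks′ (suc N)) b∈
      with g , refl ← ∈-overBlocks′⁻ b∈′
      = Ov-overBlock f g xs (levels-sound N xs∈) (levels-bounded N xs∈) f<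

    -- The last two fields carry the bound on the total through the recursion: copies of a positive
    -- value cannot outnumber the total, so a total below `F` keeps their number below the cap.
    record Split (N : ℕ) (y : List Part) : Set where
      constructor split
      field
        f    : ℕ
        g    : Bool
        xs   : List Part
        y≡   : y ≡ overBlock (suc N) f g ++ xs
        ov   : Ov xs
        bnd  : Bounded N xs
        f<   : f < multiplicity (suc N)
        f≤   : f ≤ total y
        txs  : total xs ≤ total y

    split-Ov : ∀ N y → Ov y → Bounded (suc N) y → total y < F → Split N y
    split-Ov N [] _ _ _ = split 0 false [] refl tt [] (0<multiplicity (suc N)) z≤n ≤-refl
    split-Ov N (p ∷ y) ov (p≤ ∷ b) tot< with m≤n⇒m<n∨m≡n p≤
    ... | inj₁ p< = split 0 false (p ∷ y) refl ov (Ov-bounded y ov (≤-pred p<)) (0<multiplicity (suc N)) z≤n ≤-refl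
    split-Ov N ((_ , true) ∷ y) (fol , _ , _ , ov) (p≤ ∷ b) tot< | inj₂ refl =
      split 0 true y refl ov (bounded y fol ov) (0<multiplicity (suc N)) z≤n (m≤n+m _ (suc N))
      where
      bounded : ∀ y → Follows (suc N , true) y → Ov y → Bounded N y
      bounded []      _        _  = []
      bounded (q ∷ y) (_ , lt) ov = Ov-bounded y ov (≤-pred (lt refl))
    split-Ov N ((_ , false) ∷ y) (fol , _ , av , ov) (p≤ ∷ b) tot< | inj₂ refl
      with split-Ov N y ov b (≤-<-trans (m≤n+m _ (suc N)) tot<)
    ... | split f g xs refl ovx bnd f< f≤ txs =
      split (suc f) g xs (cons g) ovx bnd (multiplicity-avoids (av refl) (≤-<-trans f+1≤ tot<)) f+1≤
        (≤-trans txs (m≤n+m _ (suc N)))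
      where
      f+1≤ : suc f ≤ suc N + total (overBlock (suc N) f g ++ xs)
      f+1≤ = s≤s (≤-trans f≤ (m≤n+m _ N))
      cons : ∀ g → (suc N , false) ∷ overBlock (suc N) f g ++ xs ≡ overBlock (suc N) (suc f) g ++ xs
      cons false = refl
      cons true  = refl

    levels-complete : ∀ N {y} → Ov y → Bounded N y → total y < F → y ∈ levels N
    levels-complete zero {[]} _ _ _ = here refl
    levels-complete zero {p ∷ _} (_ , pos , _) (p≤0 ∷ _) _ = contradiction p≤0 (<⇒≱ pos)
    levels-complete (suc N) {y} ovy b tot< with split f g xs refl ov bnd f< f≤ txs ← split-Ov N y ovy b tot< =
      ∈-extend⁺ (suc N) (levels-complete N ov bnd (≤-<-trans txs tot<))
        (∈-tab⁺ (overBlocks′ (suc N)) f< (∈-overBlocks′⁺ (suc N) f g))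

    Ov⇒Good : ∀ ps → Ov ps → NonIncr ps × LastOcc ps × AllPos ps × AvoidRes m r ps
    Ov⇒Good [] _ = tt , tt , tt , tt
    Ov⇒Good (p ∷ []) (_ , pos , av , _) = tt , tt , (pos , tt) , (av , tt)
    Ov⇒Good (p ∷ q ∷ ps) ((q≤p , lt) , pos , av , ov) with ni , lo , ap , ar ← Ov⇒Good (q ∷ ps) ov =
      (q≤p , ni) , (lt , lo) , (pos , ap) , (av , ar)

    Good⇒Ov : ∀ ps → NonIncr ps → LastOcc ps → AllPos ps → AvoidRes m r ps → Ov ps
    Good⇒Ov [] _ _ _ _ = tt
    Good⇒Ov (p ∷ []) _ _ (pos , _) (av , _) = tt , pos , av , tt
    Good⇒Ov (p ∷ q ∷ ps) (q≤p , ni) (lt , lo) (pos , ap) (av , ar) =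
      (q≤p , lt) , pos , av , Good⇒Ov (q ∷ ps) ni lo ap ar

    over-count : ∀ {N n} → n ≤ N → n < F →
      HasCount (λ ps → IsOverpartition n ps × AvoidRes m r ps) (length (filter (λ x → total x ≟ n) (levels N)))
    over-count {N} {n} n≤N n<F = hasCount (levels N) n (levels-unique N) λ ps → mk⇔
      (λ (ps∈ , eq) → let ni , lo , ap , ar = Ov⇒Good ps (levels-sound N ps∈) in (ni , lo , ap , eq) , ar)
      (λ ((ni , lo , ap , eq) , ar) →
        levels-complete N (Good⇒Ov ps ni lo ap ar)
          (All.map (λ r → ≤-trans r (≤-trans (≤-reflexive eq) n≤N)) (total-bounded ps))
          (≤-<-trans (≤-reflexive eq) n<F) , eq)

open PowerSeries using (X-off; X-diag; X-below; seriesRing; const-morphism)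
open Truncated
open Partitions

-- Generating functions of the enumerated lists

module GeneratingFunctions (trunc : Truncation) where

  open Truncation trunc
  open CommutativeRing R
  open Identities trunc
  open import Data.Bool using (true; false)
  open import Data.List using (List; []; _∷_; _++_; map; concatMap)
  open import Data.List.Membership.Propositional using (_∈_)
  open import Data.List.Properties using (++-assoc)
  open import Data.List.Relation.Unary.Any using (here; there)
  open import Data.Nat.DivMod using (_%_; m<n⇒m%n≡m; [m+kn]%n≡m%n; [m+n]%n≡m%n)
  open import Relation.Binary.Definitions using (tri<; tri≈; tri>)
  open import Relation.Binary.PropositionalEquality as ≡ using (_≡_; _≢_)
  open import Relation.Binary.Reasoning.Setoid setoid

  ΣL : {A : Set} → (A → Carrier) → List A → Carrier
  ΣL F []       = 0#
  ΣL F (x ∷ xs) = F x + ΣL F xs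

  ΣL-cong : ∀ {A : Set} {F G : A → Carrier} xs → (∀ {x} → x ∈ xs → F x ≈ G x) → ΣL F xs ≈ ΣL G xs
  ΣL-cong []       p = refl
  ΣL-cong (x ∷ xs) p = +-cong (p (here ≡.refl)) (ΣL-cong xs (p ∘ there))

  ΣL-++ : ∀ {A : Set} (F : A → Carrier) xs ys → ΣL F (xs ++ ys) ≈ ΣL F xs + ΣL F ys
  ΣL-++ F []       ys = sym (+-identityˡ _)
  ΣL-++ F (x ∷ xs) ys = trans (+-congˡ (ΣL-++ F xs ys)) (sym (+-assoc _ _ _))

  ΣL-*ʳ : ∀ {A : Set} (F : A → Carrier) c xs → ΣL (λ x → F x * c) xs ≈ ΣL F xs * c
  ΣL-*ʳ F c []       = sym (zeroˡ c)
  ΣL-*ʳ F c (x ∷ xs) = trans (+-congˡ (ΣL-*ʳ F c xs)) (sym (distribʳ c _ _))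

  ΣL-map : ∀ {A B : Set} (F : B → Carrier) (g : A → B) xs → ΣL F (map g xs) ≈ ΣL (F ∘ g) xs
  ΣL-map F g []       = refl
  ΣL-map F g (x ∷ xs) = +-congˡ (ΣL-map F g xs)

  ΣL-extend : ∀ (F : List Part → Carrier) (B : List Part → List (List Part)) L →
    ΣL F (concatMap (λ xs → map (_++ xs) (B xs)) L) ≈ ΣL (λ xs → ΣL (λ b → F (b ++ xs)) (B xs)) L
  ΣL-extend F B []       = refl
  ΣL-extend F B (xs ∷ L) = trans (ΣL-++ F (map (_++ xs) (B xs)) _)
    (+-cong (ΣL-map F (_++ xs) (B xs)) (ΣL-extend F B L))

  ΣL-tab : ∀ {A : Set} (F : A → Carrier) n g → ΣL F (tab n g) ≈ Σ< n (λ f → ΣL F (g f))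
  ΣL-tab F zero    g = refl
  ΣL-tab F (suc n) g = trans (ΣL-++ F (tab n g) (g n)) (+-congʳ (ΣL-tab F n g))

  X-rep : ∀ v f xs → X (total (rep v f ++ xs)) ≈ X (total xs) * X (f ℕ.* v)
  X-rep v f xs = trans (X-split (≡.trans (total-++ (rep v f) xs) (≡.cong (ℕ._+ total xs) (total-replicate f _))))
    (*-comm _ _)

  Π⁺ Π⁻ : ℕ → Carrier
  Π⁺ N = Π< N (λ j → 1# + X (suc j))
  Π⁻ N = Π< N (λ j → 1# - X (suc j))

  -- The truncated ring has zero divisors, but each factor 1 - q^j with j > 0 is a unit with inverse
  -- `inv⁻ j`.
  Π⁻-cancel : ∀ N {a b} → a * Π⁻ N ≈ b * Π⁻ N → a ≈ b
  Π⁻-cancel zero    eq = trans (sym (*-identityʳ _)) (trans eq (*-identityʳ _))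
  Π⁻-cancel (suc N) {a} {b} eq = Π⁻-cancel N (trans (sym (undo a)) (trans (*-congʳ eq) (undo b)))
    where
    undo : ∀ a → a * (Π⁻ N * (1# - X (suc N))) * inv⁻ (suc N) ≈ a * Π⁻ N
    undo a = trans (*-congʳ (sym (*-assoc _ _ _))) (trans (*-assoc _ _ _)
      (trans (*-congˡ (inv⁻-inverse (s≤s z≤n))) (*-identityʳ _)))

  ratio-Π : ∀ N → ratio 0 N * Π⁺ N ≈ Π⁻ N
  ratio-Π zero    = *-identityʳ 1#
  ratio-Π (suc N) = begin
    ratio 0 (suc N) * (Π⁺ N * (1# + X (suc N))) ≈⟨ *-congˡ (*-comm _ _) ⟩
    ratio 0 (suc N) * ((1# + X (suc N)) * Π⁺ N) ≈⟨ *-assoc _ _ _ ⟨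
    ratio 0 (suc N) * (1# + X (suc N)) * Π⁺ N   ≈⟨ *-congʳ (ratio-last 0 N) ⟩
    ratio 0 N * (1# - X (suc N)) * Π⁺ N         ≈⟨ trans (*-assoc _ _ _) (trans (*-congˡ (*-comm _ _)) (sym (*-assoc _ _ _))) ⟩
    ratio 0 N * Π⁺ N * (1# - X (suc N))         ≈⟨ *-congʳ (ratio-Π N) ⟩
    Π⁻ N * (1# - X (suc N))                     ∎

  -- The weighted sum over superpartitions

  module SuperGF (k i : ℕ) (3≤k : 3 ≤ k) (2≤i : 2 ≤ i) (i≤k∸1 : i ≤ k ℕ.∸ 1) where

    open Super k i 3≤k 2≤i i≤k∸1
    open Theta k

    0<k : 0 < k
    0<k = ℕ.≤-trans (s≤s z≤n) 3≤k

    weight : ℕ → List Part → Carrier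
    weight N xs = X (total xs) * T N (k ℕ.∸ count≥ N xs) (count≥ N xs)

    superGF : ℕ → Carrier
    superGF N = ΣL (X ∘ total) (levels N)

    -- The formula covers f = k-1 as well: the overlined block is absent there, and the second
    -- summand vanishes by `T-zero`.
    block-weight : ∀ N f xs → Bounded N xs → f < k →
      ΣL (λ b → weight (suc N) (b ++ xs)) (blocks′ (suc N) f) ≈ X (total xs) * (X (suc N ℕ.* f) *
        (T (suc N) (k ℕ.∸ f) f + X (suc N) * T (suc N) (k ℕ.∸ suc f) (suc f)))
    block-weight N f xs b f<k = begin
      ΣL F (blocks′ (suc N) f)                                ≈⟨ main ⟩
      x * X (f ℕ.* suc N) * T₀ + x * X (suc f ℕ.* suc N) * T₁
        ≈⟨ +-cong (*-congʳ (*-congˡ (X-≡ (ℕ.*-comm f (suc N)))))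
                  (*-congʳ (*-congˡ (X-split (≡.cong (suc N ℕ.+_) (ℕ.*-comm f (suc N)))))) ⟩
      x * y₀ * T₀ + x * (v * y₀) * T₁
        ≈⟨ +-cong (*-assoc _ _ _) (trans (*-congʳ (*-congˡ (*-comm v y₀)))
             (trans (*-assoc _ _ _) (*-congˡ (*-assoc _ _ _)))) ⟩
      x * (y₀ * T₀) + x * (y₀ * (v * T₁))                     ≈⟨ distribˡ _ _ _ ⟨
      x * (y₀ * T₀ + y₀ * (v * T₁))                           ≈⟨ *-congˡ (distribˡ _ _ _) ⟨
      x * (y₀ * (T₀ + v * T₁))                                ∎
      where
      F : List Part → Carrier
      F b = weight (suc N) (b ++ xs)
      x = X (total xs)
      v = X (suc N)
      y₀ = X (suc N ℕ.* f)
      T₀ = T (suc N) (k ℕ.∸ f) f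
      T₁ = T (suc N) (k ℕ.∸ suc f) (suc f)
      plain-weight : F (superBlock (suc N) f false) ≈ x * X (f ℕ.* suc N) * T₀
      plain-weight = *-cong (X-rep (suc N) f xs)
        (reflexive (≡.cong (λ c → T (suc N) (k ℕ.∸ c) c) (count≥-superBlock f false xs b)))
      overlined-weight : F (superBlock (suc N) f true) ≈ x * X (suc f ℕ.* suc N) * T₁
      overlined-weight = *-cong (X-rep (suc N) (suc f) xs)
        (reflexive (≡.cong (λ c → T (suc N) (k ℕ.∸ c) c) (count≥-superBlock f true xs b)))
      main : ΣL F (blocks′ (suc N) f) ≈ x * X (f ℕ.* suc N) * T₀ + x * X (suc f ℕ.* suc N) * T₁
      main with suc f ℕ.<? k
      ... | yes _ = +-cong plain-weight (trans (+-identityʳ _) overlined-weight)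
      ... | no ¬p = +-cong plain-weight (sym (trans (*-congˡ T₁≈0) (zeroʳ _)))
        where
        k≡ : k ≡ suc f
        k≡ = ℕ.≤-antisym (ℕ.≮⇒≥ ¬p) f<k
        T₁≈0 : T₁ ≈ 0#
        T₁≈0 = trans (reflexive (≡.cong (λ d → T (suc N) d (suc f)) (ℕ.m≤n⇒m∸n≡0 (ℕ.≤-reflexive k≡))))
          (T-zero (suc N) k≡)

    weight-step : ∀ N → ΣL (weight (suc N)) (levels (suc N)) ≈ ΣL (weight N) (levels N)
    weight-step N = trans (ΣL-extend (weight (suc N)) (superBlocks (suc N)) (levels N))
      (ΣL-cong (levels N) λ {xs} xs∈ → let b = levels-bounded N xs∈ ; c = count≥ N xs in begin
        ΣL (λ b → weight (suc N) (b ++ xs)) (tab (k ℕ.∸ c) (blocks′ (suc N)))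
          ≈⟨ ΣL-tab _ (k ℕ.∸ c) (blocks′ (suc N)) ⟩
        Σ< (k ℕ.∸ c) (λ f → ΣL (λ b → weight (suc N) (b ++ xs)) (blocks′ (suc N) f))
          ≈⟨ Σ<-cong (k ℕ.∸ c) (λ f f< → block-weight N f xs b (ℕ.<-≤-trans f< (ℕ.m∸n≤m k c))) ⟩
        Σ< (k ℕ.∸ c) (λ f → X (total xs) * (X (suc N ℕ.* f) *
          (T (suc N) (k ℕ.∸ f) f + X (suc N) * T (suc N) (k ℕ.∸ suc f) (suc f))))
          ≈⟨ Σ<-*ˡ (k ℕ.∸ c) _ _ ⟩
        X (total xs) * Σ< (k ℕ.∸ c) (λ f → X (suc N ℕ.* f) *
          (T (suc N) (k ℕ.∸ f) f + X (suc N) * T (suc N) (k ℕ.∸ suc f) (suc f)))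
          ≈⟨ *-congˡ (T-telescope N (k ℕ.∸ c) c
               (ℕ.m∸n+n≡m (ℕ.<⇒≤ (count≥<k xs (levels-sound N xs∈) b)))) ⟨
        weight N xs ∎)

    weight-invariant : ∀ N → ΣL (weight N) (levels N) ≈ ΣL (weight 0) (levels 0)
    weight-invariant zero    = refl
    weight-invariant (suc N) = trans (weight-step N) (weight-invariant N)

    weight-limit : ∀ N → D ≤ N → ΣL (weight N) (levels N) ≈ superGF N * ratio 0 N
    weight-limit N D≤N = trans (ΣL-cong (levels N) step) (ΣL-*ʳ (X ∘ total) (ratio 0 N) (levels N))
      where
      step : ∀ {xs} → xs ∈ levels N → weight N xs ≈ X (total xs) * ratio 0 N
      -- Positivity of k-c excludes index 0, the one index where the limit is not `ratio 0 N`.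
      step {xs} xs∈ with k ℕ.∸ count≥ N xs | ℕ.m<n⇒0<n∸m (count≥<k xs (levels-sound N xs∈) (levels-bounded N xs∈))
      ... | suc j | _ = *-congˡ (T-limit N j (count≥ N xs) D≤N 0<k)

    -- The two lists with parts at most 0 are the empty one and the overlined 0 alone. Their counts
    -- k-i and k-i+1 give the indices i and i-1, one for each family of overpartitions.
    weight-base : ΣL (weight 0) (levels 0) ≈ T 0 i (k ℕ.∸ i) + T 0 (i ℕ.∸ 1) (k ℕ.∸ (i ℕ.∸ 1))
    weight-base = +-cong
      (trans (*-congʳ X-0) (trans (*-identityˡ _) (reflexive (≡.cong (λ a → T 0 a (k ℕ.∸ i)) (ℕ.m∸[m∸n]≡n i≤k)))))
      (trans (+-identityʳ _) (trans (*-congʳ X-0) (trans (*-identityˡ _)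
        (reflexive (≡.cong₂ (T 0) (≡.trans (≡.cong (k ℕ.∸_) 1+[k∸i]) (ℕ.m∸[m∸n]≡n (ℕ.≤-trans (ℕ.m∸n≤m i 1) i≤k))) 1+[k∸i])))))
      where
      1+[k∸i] : suc (k ℕ.∸ i) ≡ k ℕ.∸ (i ℕ.∸ 1)
      1+[k∸i] = ≡.sym (ℕ.+-cancelʳ-≡ (i ℕ.∸ 1) _ _ (≡.trans (ℕ.m∸n+n≡m (ℕ.≤-trans (ℕ.m∸n≤m i 1) i≤k))
        (≡.sym (≡.trans (≡.sym (ℕ.+-suc (k ℕ.∸ i) (i ℕ.∸ 1)))
          (≡.trans (≡.cong (k ℕ.∸ i ℕ.+_) (ℕ.m+[n∸m]≡n (ℕ.≤-trans (s≤s z≤n) 2≤i))) (ℕ.m∸n+n≡m i≤k))))))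

    superGF-product : ∀ N → D ≤ N →
      superGF N * Π⁻ N ≈ (T 0 i (k ℕ.∸ i) + T 0 (i ℕ.∸ 1) (k ℕ.∸ (i ℕ.∸ 1))) * Π⁺ N
    superGF-product N D≤N = begin
      superGF N * Π⁻ N                ≈⟨ *-congˡ (ratio-Π N) ⟨
      superGF N * (ratio 0 N * Π⁺ N)  ≈⟨ *-assoc _ _ _ ⟨
      superGF N * ratio 0 N * Π⁺ N    ≈⟨ *-congʳ (weight-limit N D≤N) ⟨
      ΣL (weight N) (levels N) * Π⁺ N ≈⟨ *-congʳ (trans (weight-invariant N) weight-base) ⟩
      _ ∎

  -- The product for overpartitions

  module OverGF (m r : ℕ) .{{_ : ℕ.NonZero m}} where

    open Over m r D 0<D

    overGF : ℕ → Carrier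
    overGF N = ΣL (X ∘ total) (levels N)

    -- What remains of the factor 1 - q^v once it is multiplied by the series of the plain parts v:
    -- an admissible v cancels it, a forbidden v leaves it intact.
    excluded : ℕ → Carrier
    excluded v with avoids? v
    ... | yes _ = 1#
    ... | no  _ = 1# - X v

    geometric-multiplicity : ∀ v → 0 < v → Σ< (multiplicity v) (λ f → X (f ℕ.* v)) * (1# - X v) ≈ excluded v
    geometric-multiplicity v 0<v with avoids? v
    ... | yes _ = trans (*-comm _ _) (inv⁻-inverse 0<v)
    ... | no  _ = trans (*-congʳ (trans (+-identityˡ _) X-0)) (*-identityˡ _)

    overGF-suc : ∀ N → overGF (suc N) ≈
      overGF N * ((1# + X (suc N)) * Σ< (multiplicity (suc N)) (λ f → X (f ℕ.* suc N)))
    overGF-suc N = trans (ΣL-extend (X ∘ total) (overBlocks (suc N)) (levels N))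
      (trans (ΣL-cong (levels N) λ {xs} _ → begin
        ΣL (λ b → X (total (b ++ xs))) (tab M (overBlocks′ v)) ≈⟨ ΣL-tab _ M _ ⟩
        Σ< M (λ f → ΣL (λ b → X (total (b ++ xs))) (overBlocks′ v f)) ≈⟨ Σ<-cong M (λ f _ → step f xs) ⟩
        Σ< M (λ f → X (total xs) * (1# + X v) * X (f ℕ.* v)) ≈⟨ Σ<-*ˡ M _ _ ⟩
        X (total xs) * (1# + X v) * Σ< M (λ f → X (f ℕ.* v)) ≈⟨ *-assoc _ _ _ ⟩
        X (total xs) * ((1# + X v) * Σ< M (λ f → X (f ℕ.* v))) ∎)
        (ΣL-*ʳ _ _ (levels N)))
      where
      v = suc N
      M = multiplicity v
      overline : ∀ f xs → X (total (overBlock v f true ++ xs)) ≈ X (total xs) * X v * X (f ℕ.* v)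
      overline f xs = trans (reflexive (≡.cong (X ∘ total) (++-assoc (rep v f) ((v , true) ∷ []) xs)))
        (trans (X-rep v f ((v , true) ∷ xs)) (*-congʳ (trans (X-+ v (total xs)) (*-comm _ _))))
      step : ∀ f xs → ΣL (λ b → X (total (b ++ xs))) (overBlocks′ v f) ≈ X (total xs) * (1# + X v) * X (f ℕ.* v)
      step f xs = trans (+-cong (trans (X-rep v f xs) (*-congʳ (sym (*-identityʳ _)))) (trans (+-identityʳ _) (overline f xs)))
        (trans (sym (distribʳ _ _ _)) (*-congʳ (sym (distribˡ _ _ _))))

    overGF-product : ∀ N → overGF N * Π⁻ N ≈ Π< N (λ j → excluded (suc j)) * Π⁺ N
    overGF-product zero    = *-congʳ (trans (+-identityʳ _) X-0)
    overGF-product (suc N) = begin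
      overGF (suc N) * (Π⁻ N * (1# - X (suc N))) ≈⟨ *-congʳ (overGF-suc N) ⟩
      O * (A * G) * (P * B)       ≈⟨ shuffle O A G P B ⟩
      O * P * (G * B) * A         ≈⟨ *-congʳ (*-cong (overGF-product N) (geometric-multiplicity (suc N) (s≤s z≤n))) ⟩
      Q * Π⁺ N * excluded (suc N) * A ≈⟨ shuffle′ Q (Π⁺ N) (excluded (suc N)) A ⟩
      Q * excluded (suc N) * (Π⁺ N * A) ∎
      where
      O = overGF N
      A = 1# + X (suc N)
      B = 1# - X (suc N)
      P = Π⁻ N
      G = Σ< (multiplicity (suc N)) (λ f → X (f ℕ.* suc N))
      Q = Π< N (λ j → excluded (suc j))
      shuffle : ∀ o a g p b → o * (a * g) * (p * b) ≈ o * p * (g * b) * a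
      shuffle = solve 5 (λ o a g p b → o :* (a :* g) :* (p :* b) := o :* p :* (g :* b) :* a) refl
      shuffle′ : ∀ q p e a → q * p * e * a ≈ q * e * (p * a)
      shuffle′ = solve 4 (λ q p e a → q :* p :* e :* a := q :* e :* (p :* a)) refl

    excluded-avoids : ∀ {v} → Avoids m r v → excluded v ≈ 1#
    excluded-avoids {v} av with avoids? v
    ... | yes _  = refl
    ... | no ¬av = contradiction av ¬av

    excluded-¬avoids : ∀ {v} → ¬ Avoids m r v → excluded v ≈ 1# - X v
    excluded-¬avoids {v} ¬av with avoids? v
    ... | yes av = contradiction av ¬av
    ... | no _   = refl

    module _ (r̄ : ℕ) (r+r̄ : r ℕ.+ r̄ ≡ m) (0<r : 0 < r) (r<r̄ : r < r̄) where

      private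
        r̄<m : r̄ < m
        r̄<m = ℕ.≤-trans (ℕ.+-monoˡ-≤ r̄ 0<r) (ℕ.≤-reflexive r+r̄)

      residue-avoids : ∀ l s → suc s < m → suc s ≢ r → suc s ≢ r̄ → Avoids m r (suc s ℕ.+ l ℕ.* m)
      residue-avoids l s s<m s≢r s≢r̄ =
        (λ c → zero-residue s<m (≡.trans (≡.sym ([m+kn]%n≡m%n (suc s) l m)) (CongMod⇒% m c))) ,
        (λ c → s≢r (≡.trans (≡.sym (m<n⇒m%n≡m s<m)) (≡.trans (≡.sym ([m+kn]%n≡m%n (suc s) l m))
          (≡.trans (CongMod⇒% m c) (m<n⇒m%n≡m (ℕ.<-trans r<r̄ r̄<m)))))) ,
        (λ c → sum-residue (≡.trans (≡.sym ([m+kn]%n≡m%n (suc s ℕ.+ r) l m))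
          (≡.trans (≡.cong (_% m) (swap (suc s) r (l ℕ.* m))) (CongMod⇒% m c))))
        where
        swap : ∀ a b c → a ℕ.+ b ℕ.+ c ≡ a ℕ.+ c ℕ.+ b
        swap = solve-∀
        zero-residue : ∀ {a} → suc a < m → suc a % m ≢ 0 % m
        zero-residue a<m eq with () ← ≡.trans (≡.sym (m<n⇒m%n≡m a<m)) (≡.trans eq (m<n⇒m%n≡m (ℕ.≤-<-trans z≤n a<m)))
        -- The sum lies strictly between 0 and 2m, and s+1 ≠ r̄ means that it is not m. Above m,
        -- subtracting m leaves s+1-r̄, which is positive and below m.
        sum-residue : (suc s ℕ.+ r) % m ≢ 0 % m
        sum-residue eq with ℕ.<-cmp (suc s) r̄
        ... | tri< s<r̄ _ _ = zero-residue
              (ℕ.<-≤-trans (ℕ.+-monoˡ-< r s<r̄) (ℕ.≤-reflexive (≡.trans (ℕ.+-comm r̄ r) r+r̄))) eq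
        ... | tri≈ _ s≡r̄ _ = s≢r̄ s≡r̄
        ... | tri> _ _ r̄<s = zero-residue d<m (≡.trans (≡.sym ([m+n]%n≡m%n (suc d) m)) (≡.trans (≡.cong (_% m) d+m) eq))
          where
          d : ℕ
          d = suc s ℕ.∸ suc r̄
          1+d : suc d ℕ.+ r̄ ≡ suc s
          1+d = ≡.trans (≡.sym (ℕ.+-suc d r̄)) (ℕ.m∸n+n≡m r̄<s)
          d+m : suc d ℕ.+ m ≡ suc s ℕ.+ r
          d+m = ≡.trans (≡.cong (suc d ℕ.+_) (≡.trans (≡.sym r+r̄) (ℕ.+-comm r r̄)))
            (≡.trans (≡.sym (ℕ.+-assoc (suc d) r̄ r)) (≡.cong (ℕ._+ r) 1+d))
          d<m : suc d < m
          d<m = ℕ.≤-<-trans (ℕ.≤-trans (ℕ.m≤m+n (suc d) r̄) (ℕ.≤-reflexive 1+d)) s<m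

      -- The share of a single residue `a` in the l-th period, so that the product over the period
      -- collapses to one factor. Since `suc s` runs from 1 to m, residue 0 is represented by m.
      spike : ℕ → ℕ → ℕ → Carrier
      spike a l s with suc s ℕ.≟ a
      ... | yes _ = 1# - X (suc s ℕ.+ l ℕ.* m)
      ... | no  _ = 1#

      spike-at : ∀ {a} l s → suc s ≡ a → spike a l s ≈ 1# - X (suc s ℕ.+ l ℕ.* m)
      spike-at {a} l s eq with suc s ℕ.≟ a
      ... | yes _  = refl
      ... | no neq = contradiction eq neq

      spike-off : ∀ {a} l s → suc s ≢ a → spike a l s ≈ 1#
      spike-off {a} l s neq with suc s ℕ.≟ a
      ... | yes eq = contradiction eq neq
      ... | no _   = refl

      Π-spike-before : ∀ n {a} l → n < a → Π< n (spike a l) ≈ 1#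
      Π-spike-before zero    l _   = refl
      Π-spike-before (suc n) {a} l n<a = trans (*-cong (Π-spike-before n l (ℕ.<-trans (ℕ.n<1+n n) n<a))
        (spike-off l n (ℕ.<⇒≢ n<a))) (*-identityʳ 1#)

      Π-spike : ∀ n {a} l → 0 < a → a ≤ n → Π< n (spike a l) ≈ 1# - X (a ℕ.+ l ℕ.* m)
      Π-spike zero    l (s≤s _) ()
      Π-spike (suc n) {a} l 0<a a≤ with a ℕ.≟ suc n
      ... | yes ≡.refl = trans (*-cong (Π-spike-before n l ℕ.≤-refl) (spike-at {suc n} l n ≡.refl)) (*-identityˡ _)
      ... | no neq = trans (*-cong (Π-spike n l 0<a (ℕ.≤-pred (ℕ.≤∧≢⇒< a≤ neq)))
              (spike-off l n (neq ∘ ≡.sym))) (*-identityʳ _)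

      -- The inequalities r < r̄ < m keep the three forbidden residues distinct, so at most one
      -- spike differs from 1 and no factor is squared.
      excluded-spikes : ∀ l s → s < m → excluded (suc (l ℕ.* m ℕ.+ s)) ≈ spike m l s * (spike r l s * spike r̄ l s)
      excluded-spikes l s s<m = trans (reflexive (≡.cong (excluded ∘ suc) (ℕ.+-comm (l ℕ.* m) s))) cases
        where
        v = suc s ℕ.+ l ℕ.* m
        cases : excluded v ≈ spike m l s * (spike r l s * spike r̄ l s)
        cases with suc s ℕ.≟ m | suc s ℕ.≟ r | suc s ℕ.≟ r̄
        ... | yes s≡m | yes s≡r | _ = contradiction (≡.trans (≡.sym s≡r) s≡m) (ℕ.<⇒≢ (ℕ.<-trans r<r̄ r̄<m))
        ... | yes s≡m | _ | yes s≡r̄ = contradiction (≡.trans (≡.sym s≡r̄) s≡m) (ℕ.<⇒≢ r̄<m)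
        ... | _ | yes s≡r | yes s≡r̄ = contradiction (≡.trans (≡.sym s≡r) s≡r̄) (ℕ.<⇒≢ r<r̄)
        ... | yes s≡m | no _ | no _ = trans (excluded-¬avoids (λ (c , _) → c (0 , suc l ,
                ≡.trans (ℕ.+-identityʳ v) (≡.cong (ℕ._+ l ℕ.* m) s≡m))))
                (sym (trans (*-congˡ (*-identityʳ 1#)) (*-identityʳ _)))
        ... | no _ | yes s≡r | no _ = trans (excluded-¬avoids (λ (_ , c , _) → c (0 , l ,
                ≡.trans (ℕ.+-identityʳ v) (≡.cong (ℕ._+ l ℕ.* m) s≡r))))
                (sym (trans (*-identityˡ _) (*-identityʳ _)))
        ... | no _ | no _ | yes s≡r̄ = trans (excluded-¬avoids (λ (_ , _ , c) → c (0 , suc l ,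
                ≡.trans (ℕ.+-identityʳ (v ℕ.+ r)) (≡.trans (rotate (suc s) (l ℕ.* m) r)
                  (≡.cong (ℕ._+ l ℕ.* m) (≡.trans (≡.cong (r ℕ.+_) s≡r̄) r+r̄))))))
                (sym (trans (*-identityˡ _) (*-identityˡ _)))
          where
          rotate : ∀ a b c → a ℕ.+ b ℕ.+ c ≡ c ℕ.+ a ℕ.+ b
          rotate = solve-∀
        ... | no s≢m | no s≢r | no s≢r̄ = trans
                (excluded-avoids (residue-avoids l s (ℕ.≤∧≢⇒< s<m s≢m) s≢r s≢r̄))
                (sym (trans (*-congˡ (*-identityʳ 1#)) (*-identityʳ 1#)))

      excluded-product : ∀ L → Π< (L ℕ.* m) (λ j → excluded (suc j)) ≈ Π< L (λ l →
        (1# - X (m ℕ.* suc l)) * ((1# - X (r ℕ.+ m ℕ.* l)) * (1# - X (r̄ ℕ.+ m ℕ.* l))))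
      excluded-product L = trans (Π<-block L m _) (Π<-cong L λ l _ → begin
        Π< m (λ s → excluded (suc (l ℕ.* m ℕ.+ s))) ≈⟨ Π<-cong m (excluded-spikes l) ⟩
        Π< m (λ s → spike m l s * (spike r l s * spike r̄ l s)) ≈⟨ trans (Π<-* m _ _) (*-congˡ (Π<-* m _ _)) ⟩
        Π< m (spike m l) * (Π< m (spike r l) * Π< m (spike r̄ l))
          ≈⟨ *-cong (Π-spike m l (ℕ.≤-<-trans z≤n r̄<m) ℕ.≤-refl)
               (*-cong (Π-spike m l 0<r (ℕ.<⇒≤ (ℕ.<-trans r<r̄ r̄<m)))
                       (Π-spike m l (ℕ.<-trans 0<r r<r̄) (ℕ.<⇒≤ r̄<m))) ⟩
        (1# - X (m ℕ.+ l ℕ.* m)) * ((1# - X (r ℕ.+ l ℕ.* m)) * (1# - X (r̄ ℕ.+ l ℕ.* m)))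
          ≈⟨ *-cong (factor (ℕ.*-comm (suc l) m))
               (*-cong (factor (≡.cong (r ℕ.+_) (ℕ.*-comm l m))) (factor (≡.cong (r̄ ℕ.+_) (ℕ.*-comm l m)))) ⟩
        (1# - X (m ℕ.* suc l)) * ((1# - X (r ℕ.+ m ℕ.* l)) * (1# - X (r̄ ℕ.+ m ℕ.* l))) ∎)
        where
        factor : ∀ {a b} → a ≡ b → 1# - X a ≈ 1# - X b
        factor ≡.refl = refl

  -- Comparison of the two sides

  module _ (k i : ℕ) (3≤k : 3 ≤ k) (2≤i : 2 ≤ i) (i≤k∸1 : i ≤ k ℕ.∸ 1)
           .{{_ : ℕ.NonZero (2 ℕ.* k)}} where

    open SuperGF k i 3≤k 2≤i i≤k∸1
    open Theta k

    private
      -- A whole number of periods 2k, and exactly the D + D periods over which the triple product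
      -- extends.
      M : ℕ
      M = (D ℕ.+ D) ℕ.* (2 ℕ.* k)

      D≤M : D ≤ M
      D≤M = ℕ.≤-trans (ℕ.m≤m+n D D) (ℕ.m≤m*n (D ℕ.+ D) (2 ℕ.* k))

    overGF-theta : ∀ r → 0 < r → r < k →
      OverGF.overGF (2 ℕ.* k) r M * Π⁻ M ≈ T 0 r (k ℕ.∸ r) * Π⁺ M
    overGF-theta r 0<r r<k = trans (overGF-product M) (*-congʳ (trans
      (excluded-product (k ℕ.+ (k ℕ.∸ r)) r+r̄ 0<r (ℕ.<-≤-trans r<k (ℕ.m≤m+n k _)) (D ℕ.+ D))
      (sym (T-product r (k ℕ.∸ r) (ℕ.m+[n∸m]≡n (ℕ.<⇒≤ r<k)) 0<r))))
      where
      open OverGF (2 ℕ.* k) r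
      open Jacobi 0<k
      swap : ∀ a b c → a ℕ.+ (b ℕ.+ c) ≡ b ℕ.+ (a ℕ.+ c)
      swap = solve-∀
      r+r̄ : r ℕ.+ (k ℕ.+ (k ℕ.∸ r)) ≡ 2 ℕ.* k
      r+r̄ = ≡.trans (swap r k (k ℕ.∸ r)) (≡.cong (k ℕ.+_) (≡.trans (ℕ.m+[n∸m]≡n (ℕ.<⇒≤ r<k)) (≡.sym (ℕ.+-identityʳ k))))

    superGF≈overGF : superGF M ≈ OverGF.overGF (2 ℕ.* k) i M + OverGF.overGF (2 ℕ.* k) (i ℕ.∸ 1) M
    superGF≈overGF = Π⁻-cancel M (begin
      superGF M * Π⁻ M ≈⟨ superGF-product M D≤M ⟩
      (T 0 i (k ℕ.∸ i) + T 0 (i ℕ.∸ 1) (k ℕ.∸ (i ℕ.∸ 1))) * Π⁺ M ≈⟨ distribʳ _ _ _ ⟩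
      T 0 i (k ℕ.∸ i) * Π⁺ M + T 0 (i ℕ.∸ 1) (k ℕ.∸ (i ℕ.∸ 1)) * Π⁺ M
        ≈⟨ +-cong (overGF-theta i (ℕ.<-trans (s≤s z≤n) 2≤i) i<k)
                  (overGF-theta (i ℕ.∸ 1) (ℕ.∸-monoˡ-≤ 1 2≤i) (ℕ.≤-<-trans (ℕ.m∸n≤m i 1) i<k)) ⟨
      OverGF.overGF (2 ℕ.* k) i M * Π⁻ M + OverGF.overGF (2 ℕ.* k) (i ℕ.∸ 1) M * Π⁻ M ≈⟨ distribʳ _ _ _ ⟨
      (OverGF.overGF (2 ℕ.* k) i M + OverGF.overGF (2 ℕ.* k) (i ℕ.∸ 1) M) * Π⁻ M ∎)
      where
      i<k : i < k
      i<k = ℕ.≤-trans (s≤s i≤k∸1) (ℕ.≤-reflexive (ℕ.m+[n∸m]≡n 0<k))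

seriesTruncation : ℕ → Truncation
seriesTruncation n = record
  { R        = seriesRing (suc n)
  ; morphism = const-morphism (suc n)
  ; X        = PowerSeries.X
  ; X-0      = λ _ _ → refl
  ; X-+      = λ a b d _ → PowerSeries.X-+ a b d
  ; D        = suc n
  ; 0<D      = s≤s z≤n
  ; X-high   = λ {e} D≤e d d<D → trans (X-below d (ℕ.<-≤-trans d<D D≤e)) (sym (const-0 d))
  }
  where
  open import Relation.Binary.PropositionalEquality using (_≡_; refl; sym; trans)
  const-0 : ∀ d → PowerSeries.const ℤ.0ℤ d ≡ ℤ.0ℤ
  const-0 zero    = refl
  const-0 (suc _) = refl

open import Data.List using (List; []; _∷_; length; filter)
open import Data.List.Properties using (filter-accept; filter-reject)
open import Data.Nat using (_+_; _∸_; _≟_)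
open import Relation.Binary.PropositionalEquality using (_≡_; refl; sym; trans; cong; cong₂)

-- Each list contributes a single monomial, whose coefficient at `n` is 1 or 0 according as its
-- total is `n` or not.
coefficient-ΣL : ∀ D n L → GeneratingFunctions.ΣL (seriesTruncation D) (λ x → PowerSeries.X (total x)) L n
                 ≡ ℤ.+ length (filter (λ x → total x ≟ n) L)
coefficient-ΣL D zero    []      = refl
coefficient-ΣL D (suc n) []      = refl
coefficient-ΣL D n       (x ∷ L) = cases (total x ≟ n)
  where
  cases : Dec (total x ≡ n) → _
  cases (yes eq) = trans
    (cong₂ ℤ._+_ (trans (cong (λ d → PowerSeries.X d n) eq) (X-diag n)) (coefficient-ΣL D n L))
    (cong (ℤ.+_ ∘ length) (sym (filter-accept (λ x → total x ≟ n) {x} {L} eq)))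
  cases (no neq) = trans
    (cong₂ ℤ._+_ (X-off (total x) n neq) (coefficient-ΣL D n L))
    (trans (ℤ.+-identityˡ _) (cong (ℤ.+_ ∘ length) (sym (filter-reject (λ x → total x ≟ n) {x} {L} neq))))

theorem7p3 : (k i : ℕ) → 3 ≤ k → 2 ≤ i → i ≤ k ∸ 1 → (n : ℕ) →
    ∃[ a ] ∃[ b ] ∃[ c ]
    HasCount (GoodSuper k i n) a × HasCount (GoodOver k i n) b
    × HasCount (GoodOver k (i ∸ 1) n) c × a ≡ b + c
theorem7p3 k@(suc _) i 3≤k 2≤i i≤k∸1 n =
  _ , _ , _ , super-count n≤M , over-count i n≤M ℕ.≤-refl , over-count (i ∸ 1) n≤M ℕ.≤-refl ,
  -- The truncation is at q^(n+1), the first at which the coefficient of q^n is still visible.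
  ℤ.+-injective (trans (sym (coefficient-ΣL n n (superLevels M)))
    (trans (superGF≈overGF k i 3≤k 2≤i i≤k∸1 n ℕ.≤-refl)
      (cong₂ ℤ._+_ (coefficient-ΣL n n (overLevels i M)) (coefficient-ΣL n n (overLevels (i ∸ 1) M)))))
  where
  open GeneratingFunctions (seriesTruncation n) using (superGF≈overGF)
  open Super k i 3≤k 2≤i i≤k∸1 using (super-count) renaming (levels to superLevels)
  over-count : ∀ r {N} → n ≤ N → n < suc n → HasCount (GoodOver k r n) _
  over-count r = Over.over-count (2 ℕ.* k) r (suc n) (s≤s z≤n)
  overLevels : ℕ → ℕ → List (List Part)
  overLevels r = Over.levels (2 ℕ.* k) r (suc n) (s≤s z≤n)
  M : ℕ
  M = (suc n + suc n) ℕ.* (2 ℕ.* k)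
  n≤M : n ≤ M
  n≤M = ℕ.≤-trans (ℕ.n≤1+n n) (ℕ.≤-trans (ℕ.m≤m+n (suc n) (suc n)) (ℕ.m≤m*n (suc n + suc n) (2 ℕ.* k)))
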